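{- The competitive ratio of the Round-Robin algorithm (RR) for $1\mid r_j,\mathrm{pmtn}\mid\sum C_j$, i.e. for minimizing the total completion time on a single machine with release dates and preemption, is at least $2.1906$.
   Context: Single-machine scheduling: there are $n$ jobs with release dates $r_j\ge 0$ and processing requirements $p_j>0$. At every time $t$ jobs receive processing rates $y_j(t)\ge 0$ with $\sum_jy_j(t)\le 1$ and $y_j(t)=0$ for $t<r_j$; the completion time $C_j$ is the first time $t'$ with $\int_{r_j}^{t'}y_j(t)\,\mathrm{d}t\ge p_j$. The objective is $\sum_jC_j$. RR processes at any time $t$ every available job $j\in J(t)$ (i.e. $r_j\le t<C_j$ in RR's schedule) at rate $1/|J(t)|$. The competitive ratio of RR is the supremum over all instances of the ratio between RR's objective value and the optimal offline objective value. -}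

module Defs where

open import Algebra.Properties.CommutativeMonoid.Sum using (sum)
open import Data.Bool.Base using (if_then_else_; _∧_)
open import Data.Fin.Base using (Fin)
open import Data.Fin.Subset using (Subset; _∈_; _∉_; ∣_∣)
open import Data.Integer.Base using (+_)
open import Data.List.Base using (List; []; _∷_)
open import Data.List.Relation.Unary.All using (All)
open import Data.Nat.Base using (ℕ; zero; suc)
open import Data.Product.Base using (_×_; ∃-syntax)
open import Data.Rational using (ℚ; 0ℚ; 1ℚ; _/_; _+_; _*_; _-_; _≤_; _<_)
open import Data.Rational.Properties using (_≤?_; _<?_; +-0-commutativeMonoid)
open import Data.Vec.Base using (tabulate)
open import Relation.Binary.PropositionalEquality using (_≡_)
open import Relation.Nullary.Decidable using (does)

∑ : ∀ {n} → (Fin n → ℚ) → ℚ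
∑ = sum +-0-commutativeMonoid

record Instance : Set where
  field
    jobs      : ℕ
    release   : Fin jobs → ℚ
    size      : Fin jobs → ℚ
    release≥0 : ∀ j → 0ℚ ≤ release j
    size>0    : ∀ j → 0ℚ < size j

-- Rate functions are step functions of time on [0,∞), right-continuous,
-- given as a list of consecutive pieces starting at time 0.
-- After the last piece every rate is 0.

record Piece (n : ℕ) : Set where
  constructor piece
  field
    duration : ℚ
    rates    : Fin n → ℚ

open Piece

-- Only meaningful for times t ≥ 0.
rateAt : ∀ {n} → List (Piece n) → Fin n → ℚ → ℚ
rateAt []       j t = 0ℚ
rateAt (π ∷ πs) j t =
  if does (t <? duration π)
  then rates π j
  else rateAt πs j (t - duration π)

-- The integral of rateAt πs j over [0,t].
cumulative : ∀ {n} → List (Piece n) → Fin n → ℚ → ℚ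
cumulative []       j t = 0ℚ
cumulative (π ∷ πs) j t =
  if does (t <? duration π)
  then rates π j * t
  else rates π j * duration π + cumulative πs j (t - duration π)

integral : ∀ {n} → List (Piece n) → Fin n → ℚ → ℚ → ℚ
integral πs j a b = cumulative πs j b - cumulative πs j a

record Schedule (I : Instance) : Set where
  open Instance I
  field
    pieces     : List (Piece jobs)
    duration≥0 : All (λ π → 0ℚ ≤ duration π) pieces

  rate : Fin jobs → ℚ → ℚ
  rate = rateAt pieces

  field
    rate≥0          : ∀ j t → 0ℚ ≤ t → 0ℚ ≤ rate j t
    capacity        : ∀ t → 0ℚ ≤ t → ∑ (λ j → rate j t) ≤ 1ℚ
    before-release  : ∀ j t → 0ℚ ≤ t → t < release j → rate j t ≡ 0ℚ

    -- The completion time is the first t′ by which the job is fully processed.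
    completion       : Fin jobs → ℚ
    release≤complete : ∀ j → release j ≤ completion j
    processed        : ∀ j → size j ≤ integral pieces j (release j) (completion j)
    first            : ∀ j t′ → release j ≤ t′ →
                       size j ≤ integral pieces j (release j) t′ →
                       completion j ≤ t′

  totalCompletionTime : ℚ
  totalCompletionTime = ∑ completion

  available : ℚ → Subset jobs
  available t = tabulate λ j → does (release j ≤? t) ∧ does (t <? completion j)

open Schedule

-- The value at 0 is irrelevant: it is used only for a set with an element.
reciprocal : ℕ → ℚ
reciprocal zero    = 0ℚ
reciprocal (suc k) = + 1 / suc k

IsRoundRobin : ∀ {I} → Schedule I → Set
IsRoundRobin S = ∀ j t → 0ℚ ≤ t →
  (j ∈ available S t → rate S j t ≡ reciprocal ∣ available S t ∣) ×
  (j ∉ available S t → rate S j t ≡ 0ℚ)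

IsOptimal : ∀ {I} → Schedule I → Set
IsOptimal {I} S = (S′ : Schedule I) → totalCompletionTime S ≤ totalCompletionTime S′

-- q is the ratio between the Round-Robin objective value and the optimal
-- one on some instance; 0 < optimum excludes the instance without jobs.
IsRoundRobinRatio : ℚ → Set
IsRoundRobinRatio q =
  ∃[ I ] ∃[ RR ] ∃[ OPT ]
    IsRoundRobin {I} RR × IsOptimal {I} OPT ×
    0ℚ < totalCompletionTime OPT ×
    q * totalCompletionTime OPT ≡ totalCompletionTime RR

-- c ≤ sup P, where the supremum may be irrational or infinite:
-- every number below c is exceeded by an element of P.
_≤sup_ : ℚ → (ℚ → Set) → Set
c ≤sup P = ∀ b → b < c → ∃[ q ] P q × b < q

{-# OPTIONS --safe #-}

-- A first batch of ρ + 1 jobs of size 1 is followed by K batches of two jobs.  Batch i + 1 arrives when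
-- one job of batch i could have been finished, and its size is what Round-Robin has left of every earlier
-- job at that time.  So under Round-Robin all jobs finish together at the very end, whereas the optimum
-- always runs the newest batch: one job of each batch on the way up and the remaining ones on the way down.
-- Both objective values are affine in the size s of the last batch, and s² ≤ (n₀ - 1) / (n - 1), where n₀
-- is the size of the first batch and n the number of jobs.
--
-- Optimality: at any time at which the optimum works on a batch ≥ i, it has worked on such batches only
-- since the release of batch i.  This minimises ∑ pⱼ Cⱼ over every family {batch ≥ i}, because in any
-- schedule Cⱼ is at least that release date plus the sizes of the members completed up to Cⱼ.  As 1 / pⱼ
-- increases with the batch, ∑ Cⱼ = ∑ (1 / pⱼ) pⱼ Cⱼ is a nonnegative combination of these sums.

module Submission where

open import Defs

open import Algebra.Bundles using (CommutativeRing)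
import Algebra.Properties.Semiring.Sum as Sum
open import Data.Bool.Base using (Bool; true; false; if_then_else_; _∧_)
open import Data.Bool.Properties using (¬-not; ∧-zeroʳ)
open import Data.Fin.Base using (Fin; toℕ; zero; suc)
import Data.Fin.Properties as FinP
open import Data.Fin.Subset using (Subset; _∈_; _∉_; ∣_∣)
import Data.Integer.Base as ℤ
open import Data.Integer.Base using (+_)
import Data.Integer.Properties as ℤP
open import Data.List.Base using (List; []; _∷_)
open import Data.List.Relation.Unary.All using (All; []; _∷_)
import Data.Nat.Base as ℕ
open import Data.Nat.Base using (ℕ; zero; suc)
import Data.Nat.Properties as ℕP
open import Data.Nat.Solver renaming (module +-*-Solver to ℕSolver)
open import Data.Product.Base using (_×_; _,_; ∃-syntax)
open import Data.Rational hiding (_≥_; _>_; _≃_; ∣_∣)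
open import Data.Rational.Properties
open import Data.Rational.Solver
import Data.Rational.Unnormalised.Base as ℚᵘ
open import Data.Rational.Unnormalised.Base using (mkℚᵘ; *≡*)
import Data.Rational.Unnormalised.Properties as ℚᵘP
open import Data.Sum.Base using (_⊎_; inj₁; inj₂)
open import Data.Vec.Base using (tabulate)
open import Data.Vec.Properties using (tabulate-cong; lookup∘tabulate; []=⇒lookup; lookup⇒[]=)
open import Function.Base using (_∘_)
open import Relation.Binary.Definitions using (tri<; tri≈; tri>)
open import Relation.Binary.PropositionalEquality
open import Relation.Nullary using (Dec; yes; no; ¬_; contradiction)
open import Relation.Nullary.Decidable using (does; dec-true; dec-false)

open Sum (CommutativeRing.semiring +-*-commutativeRing)
  using (sum-cong-≗; sum-replicate-zero; ∑-distrib-+; ∑-comm; *-distribˡ-sum; *-distribʳ-sum)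
open +-*-Solver using (solve; _:+_; _:*_; _:-_; :-_; _:=_; con)
open ℕSolver using () renaming (solve to solveℕ; _:+_ to _:+ℕ_; _:=_ to _:=ℕ_; con to conℕ)
open Piece

-- Rational numbers

fromℕ : ℕ → ℚ
fromℕ k = + k / 1

-- Normalisation does not compute at a variable `k`, so the identity is transported to unnormalised
-- fractions, where cross-multiplication settles it.
fromℕ-suc : ∀ k → fromℕ (suc k) ≡ 1ℚ + fromℕ k
fromℕ-suc k = toℚᵘ-injective (begin
  toℚᵘ (fromℕ (suc k))      ≈⟨ toℚᵘ-fromℚᵘ (mkℚᵘ (+ suc k) 0) ⟩
  mkℚᵘ (+ suc k) 0          ≈⟨ *≡* (cong (λ z → (+ 1 ℤ.+ z) ℤ.* + 1) (sym (ℤP.*-identityʳ (+ k)))) ⟩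
  ℚᵘ.1ℚᵘ ℚᵘ.+ mkℚᵘ (+ k) 0  ≈⟨ ℚᵘP.+-congʳ ℚᵘ.1ℚᵘ (toℚᵘ-fromℚᵘ (mkℚᵘ (+ k) 0)) ⟨
  ℚᵘ.1ℚᵘ ℚᵘ.+ toℚᵘ (fromℕ k) ≈⟨ toℚᵘ-homo-+ 1ℚ (fromℕ k) ⟨
  toℚᵘ (1ℚ + fromℕ k)       ∎)
  where open ℚᵘP.≃-Reasoning

fromℕ-+ : ∀ a b → fromℕ (a ℕ.+ b) ≡ fromℕ a + fromℕ b
fromℕ-+ zero b = sym (+-identityˡ (fromℕ b))
fromℕ-+ (suc a) b = begin
  fromℕ (suc (a ℕ.+ b))      ≡⟨ fromℕ-suc (a ℕ.+ b) ⟩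
  1ℚ + fromℕ (a ℕ.+ b)       ≡⟨ cong (_+_ 1ℚ) (fromℕ-+ a b) ⟩
  1ℚ + (fromℕ a + fromℕ b)   ≡⟨ +-assoc 1ℚ (fromℕ a) (fromℕ b) ⟨
  1ℚ + fromℕ a + fromℕ b     ≡⟨ cong (_+ fromℕ b) (fromℕ-suc a) ⟨
  fromℕ (suc a) + fromℕ b    ∎
  where open ≡-Reasoning

fromℕ*reciprocal : ∀ k → fromℕ (suc k) * reciprocal (suc k) ≡ 1ℚ
fromℕ*reciprocal k = toℚᵘ-injective (begin
  toℚᵘ (fromℕ (suc k) * reciprocal (suc k))            ≈⟨ toℚᵘ-homo-* (fromℕ (suc k)) (reciprocal (suc k)) ⟩
  toℚᵘ (fromℕ (suc k)) ℚᵘ.* toℚᵘ (reciprocal (suc k))  ≈⟨ ℚᵘP.*-cong (toℚᵘ-fromℚᵘ (mkℚᵘ (+ suc k) 0)) (toℚᵘ-fromℚᵘ (mkℚᵘ (+ 1) k)) ⟩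
  mkℚᵘ (+ suc k) 0 ℚᵘ.* mkℚᵘ (+ 1) k                   ≈⟨ *≡* (trans (ℤP.*-identityʳ (+ suc k ℤ.* + 1)) (trans (ℤP.*-identityʳ (+ suc k)) (sym (trans (ℤP.*-identityˡ (+ (1 ℕ.* suc k))) (ℤP.*-identityˡ (+ suc k)))))) ⟩
  ℚᵘ.1ℚᵘ                                               ∎)
  where open ℚᵘP.≃-Reasoning

fromℕ-injective : ∀ {a b} → fromℕ a ≡ fromℕ b → a ≡ b
fromℕ-injective {a} {b} eq with fromℚᵘ-injective {mkℚᵘ (+ a) 0} {mkℚᵘ (+ b) 0} eq
... | *≡* a*1≡b*1 = ℤP.+-injective (trans (sym (ℤP.*-identityʳ (+ a))) (trans a*1≡b*1 (ℤP.*-identityʳ (+ b))))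

0≤fromℕ : ∀ k → 0ℚ ≤ fromℕ k
0≤fromℕ k = nonNegative⁻¹ (fromℕ k) {{normalize-nonNeg k 1}}

0<fromℕ : ∀ k → 0ℚ < fromℕ (suc k)
0<fromℕ k = positive⁻¹ (fromℕ (suc k)) {{normalize-pos (suc k) 1}}

-- With the difference `e` given explicitly, what is left of an inequality is an identity for the
-- ring solver.
≤-by-gap : ∀ {p q} e → 0ℚ ≤ e → q ≡ p + e → p ≤ q
≤-by-gap {p} {q} e 0≤e q≡p+e = begin
  p       ≡⟨ +-identityʳ p ⟨
  p + 0ℚ  ≤⟨ +-monoʳ-≤ p 0≤e ⟩
  p + e   ≡⟨ q≡p+e ⟨
  q       ∎
  where open ≤-Reasoning

<-by-gap : ∀ {p q} e → 0ℚ < e → q ≡ p + e → p < q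
<-by-gap {p} {q} e 0<e q≡p+e = begin-strict
  p       ≡⟨ +-identityʳ p ⟨
  p + 0ℚ  <⟨ +-monoʳ-< p 0<e ⟩
  p + e   ≡⟨ q≡p+e ⟨
  q       ∎
  where open ≤-Reasoning

≤⇒≯ : ∀ {p q} → p ≤ q → ¬ (q < p)
≤⇒≯ p≤q q<p = <-irrefl refl (≤-<-trans p≤q q<p)

p≤q⇒0≤q-p : ∀ {p q} → p ≤ q → 0ℚ ≤ q - p
p≤q⇒0≤q-p {p} {q} p≤q = subst (_≤ q - p) (+-inverseʳ p) (+-monoˡ-≤ (- p) p≤q)

p<q⇒0<q-p : ∀ {p q} → p < q → 0ℚ < q - p
p<q⇒0<q-p {p} {q} p<q = subst (_< q - p) (+-inverseʳ p) (+-monoˡ-< (- p) p<q)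

0≤p+q : ∀ {p q} → 0ℚ ≤ p → 0ℚ ≤ q → 0ℚ ≤ p + q
0≤p+q = +-mono-≤

0≤p*q : ∀ {p q} → 0ℚ ≤ p → 0ℚ ≤ q → 0ℚ ≤ p * q
0≤p*q {p} {q} 0≤p 0≤q = subst (_≤ p * q) (*-zeroʳ p) (*-monoˡ-≤-nonNeg p {{nonNegative 0≤p}} 0≤q)

0<p*q : ∀ {p q} → 0ℚ < p → 0ℚ < q → 0ℚ < p * q
0<p*q {p} {q} 0<p 0<q = subst (_< p * q) (*-zeroʳ p) (*-monoʳ-<-pos p {{positive 0<p}} 0<q)

*-monoʳ-≤ : ∀ {r p q} → 0ℚ ≤ r → p ≤ q → p * r ≤ q * r
*-monoʳ-≤ {r} 0≤r = *-monoʳ-≤-nonNeg r {{nonNegative 0≤r}}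

*-monoˡ-≤ : ∀ {r p q} → 0ℚ ≤ r → p ≤ q → r * p ≤ r * q
*-monoˡ-≤ {r} 0≤r = *-monoˡ-≤-nonNeg r {{nonNegative 0≤r}}

-- Finite sums

∑-mono : ∀ {n} {f g : Fin n → ℚ} → (∀ j → f j ≤ g j) → ∑ f ≤ ∑ g
∑-mono {zero}  f≤g = ≤-refl
∑-mono {suc n} f≤g = +-mono-≤ (f≤g zero) (∑-mono (f≤g ∘ suc))

∑-neg : ∀ {n} (f : Fin n → ℚ) → ∑ (λ j → - f j) ≡ - ∑ f
∑-neg {zero}  f = refl
∑-neg {suc n} f = trans (cong (_+_ (- f zero)) (∑-neg (f ∘ suc))) (sym (neg-distrib-+ (f zero) (∑ (f ∘ suc))))

∑-distrib-- : ∀ {n} (f g : Fin n → ℚ) → ∑ (λ j → f j - g j) ≡ ∑ f - ∑ g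
∑-distrib-- f g = trans (∑-distrib-+ f (λ j → - g j)) (cong (_+_ (∑ f)) (∑-neg g))

-- Depends on `does` alone, like membership in `tabulate` subsets, so that the two can be exchanged.
𝟙 : ∀ {P : Set} → Dec P → ℚ
𝟙 P? = if does P? then 1ℚ else 0ℚ

module _ {P : Set} (P? : Dec P) where

  𝟙-true : P → 𝟙 P? ≡ 1ℚ
  𝟙-true p = cong (λ b → if b then 1ℚ else 0ℚ) (dec-true P? p)

  𝟙-false : ¬ P → 𝟙 P? ≡ 0ℚ
  𝟙-false ¬p = cong (λ b → if b then 1ℚ else 0ℚ) (dec-false P? ¬p)

  0≤𝟙 : 0ℚ ≤ 𝟙 P?
  0≤𝟙 with does P?
  ... | true  = nonNegative⁻¹ 1ℚ
  ... | false = ≤-refl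

  𝟙≤1 : 𝟙 P? ≤ 1ℚ
  𝟙≤1 with does P?
  ... | true  = ≤-refl
  ... | false = nonNegative⁻¹ 1ℚ

∑-𝟙-≟ : ∀ {n} (f : ℕ → ℚ) i → i ℕ.< n → ∑ {n} (λ j → 𝟙 (toℕ j ℕP.≟ i) * f (toℕ j)) ≡ f i
∑-𝟙-≟ {suc n} f zero _ = begin
  𝟙 (0 ℕP.≟ 0) * f 0 + ∑ {n} (λ j → 𝟙 (suc (toℕ j) ℕP.≟ 0) * f (suc (toℕ j)))
    ≡⟨ cong₂ _+_ (*-identityˡ (f 0)) (trans (sum-cong-≗ {n} λ j → *-zeroˡ (f (suc (toℕ j)))) (sum-replicate-zero n)) ⟩
  f 0 + 0ℚ  ≡⟨ +-identityʳ (f 0) ⟩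
  f 0       ∎
  where open ≡-Reasoning
∑-𝟙-≟ {suc n} f (suc i) (ℕ.s≤s i<n) = begin
  𝟙 (0 ℕP.≟ suc i) * f 0 + ∑ {n} (λ j → 𝟙 (suc (toℕ j) ℕP.≟ suc i) * f (suc (toℕ j)))
    ≡⟨ cong₂ _+_ (*-zeroˡ (f 0)) (∑-𝟙-≟ {n} (λ k → f (suc k)) i i<n) ⟩
  0ℚ + f (suc i)  ≡⟨ +-identityˡ (f (suc i)) ⟩
  f (suc i)       ∎
  where open ≡-Reasoning

-- Indexed by all of ℕ, so that sums can be cut anywhere. For sizes `p`, it is the time at which job
-- `k` starts when the jobs run in index order without idling.
prefix : (ℕ → ℚ) → ℕ → ℚ
prefix p zero    = 0ℚ
prefix p (suc k) = prefix p k + p k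

prefix-as-∑ : ∀ {n} p k → k ℕ.≤ n → prefix p k ≡ ∑ {n} (λ j → 𝟙 (toℕ j ℕP.<? k) * p (toℕ j))
prefix-as-∑ {n} p zero    _   = sym (trans (sum-cong-≗ {n} λ j → *-zeroˡ (p (toℕ j))) (sum-replicate-zero n))
prefix-as-∑ {n} p (suc k) k<n = begin
  prefix p k + p k
    ≡⟨ cong₂ _+_ (prefix-as-∑ p k (ℕP.<⇒≤ k<n)) (sym (∑-𝟙-≟ {n} p k k<n)) ⟩
  ∑ {n} (λ j → 𝟙 (toℕ j ℕP.<? k) * p (toℕ j)) + ∑ {n} (λ j → 𝟙 (toℕ j ℕP.≟ k) * p (toℕ j))
    ≡⟨ ∑-distrib-+ {n} (λ j → 𝟙 (toℕ j ℕP.<? k) * p (toℕ j)) (λ j → 𝟙 (toℕ j ℕP.≟ k) * p (toℕ j)) ⟨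
  ∑ {n} (λ j → 𝟙 (toℕ j ℕP.<? k) * p (toℕ j) + 𝟙 (toℕ j ℕP.≟ k) * p (toℕ j))
    ≡⟨ sum-cong-≗ {n} (λ j → trans (sym (*-distribʳ-+ (p (toℕ j)) (𝟙 (toℕ j ℕP.<? k)) (𝟙 (toℕ j ℕP.≟ k)))) (cong (_* p (toℕ j)) (split (toℕ j)))) ⟩
  ∑ {n} (λ j → 𝟙 (toℕ j ℕP.<? suc k) * p (toℕ j)) ∎
  where
  open ≡-Reasoning
  split : ∀ l → 𝟙 (l ℕP.<? k) + 𝟙 (l ℕP.≟ k) ≡ 𝟙 (l ℕP.<? suc k)
  split l with ℕP.<-cmp l k
  ... | tri< l<k l≢k _ = trans (cong₂ _+_ (𝟙-true (l ℕP.<? k) l<k) (𝟙-false (l ℕP.≟ k) l≢k)) (sym (𝟙-true (l ℕP.<? suc k) (ℕP.m<n⇒m<1+n l<k)))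
  ... | tri≈ l≮k l≡k _ = trans (cong₂ _+_ (𝟙-false (l ℕP.<? k) l≮k) (𝟙-true (l ℕP.≟ k) l≡k)) (sym (𝟙-true (l ℕP.<? suc k) (ℕ.s≤s (ℕP.≤-reflexive l≡k))))
  ... | tri> l≮k l≢k k<l = trans (cong₂ _+_ (𝟙-false (l ℕP.<? k) l≮k) (𝟙-false (l ℕP.≟ k) l≢k)) (sym (𝟙-false (l ℕP.<? suc k) (ℕP.≤⇒≯ k<l)))

∑-const : ∀ n x → ∑ {n} (λ _ → x) ≡ fromℕ n * x
∑-const zero    x = sym (*-zeroˡ x)
∑-const (suc n) x = begin
  x + ∑ {n} (λ _ → x)   ≡⟨ cong (_+_ x) (∑-const n x) ⟩
  x + fromℕ n * x       ≡⟨ solve 2 (λ x k → x :+ k :* x := (con 1ℚ :+ k) :* x) refl x (fromℕ n) ⟩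
  (1ℚ + fromℕ n) * x    ≡⟨ cong (_* x) (fromℕ-suc n) ⟨
  fromℕ (suc n) * x     ∎
  where open ≡-Reasoning

∑≡prefix : ∀ n p → ∑ {n} (λ j → p (toℕ j)) ≡ prefix p n
∑≡prefix n p = sym (trans (prefix-as-∑ {n} p n ℕP.≤-refl)
  (sum-cong-≗ {n} λ j → trans (cong (_* p (toℕ j)) (𝟙-true (toℕ j ℕP.<? n) (FinP.toℕ<n j))) (*-identityˡ (p (toℕ j)))))

prefix-const : ∀ p a m x → (∀ d → d ℕ.< m → p (a ℕ.+ d) ≡ x) → prefix p (a ℕ.+ m) ≡ prefix p a + fromℕ m * x
prefix-const p a zero    x _ rewrite ℕP.+-identityʳ a = solve 2 (λ s x → s := s :+ con 0ℚ :* x) refl (prefix p a) x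
prefix-const p a (suc m) x p≡x rewrite ℕP.+-suc a m = begin
  prefix p (a ℕ.+ m) + p (a ℕ.+ m)     ≡⟨ cong₂ _+_ (prefix-const p a m x λ d d<m → p≡x d (ℕP.m<n⇒m<1+n d<m)) (p≡x m ℕP.≤-refl) ⟩
  prefix p a + fromℕ m * x + x         ≡⟨ solve 3 (λ s k x → s :+ k :* x :+ x := s :+ (con 1ℚ :+ k) :* x) refl (prefix p a) (fromℕ m) x ⟩
  prefix p a + (1ℚ + fromℕ m) * x      ≡⟨ cong (λ k → prefix p a + k * x) (fromℕ-suc m) ⟨
  prefix p a + fromℕ (suc m) * x       ∎
  where open ≡-Reasoning

prefix-mono : ∀ p → (∀ k → 0ℚ ≤ p k) → ∀ {i k} → i ℕ.≤ k → prefix p i ≤ prefix p k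
prefix-mono p 0≤p i≤k = go (ℕP.≤⇒≤′ i≤k)
  where
  go : ∀ {i k} → i ℕ.≤′ k → prefix p i ≤ prefix p k
  go ℕ.≤′-refl                      = ≤-refl
  go {k = suc k} (ℕ.≤′-step i≤′k) = ≤-trans (go i≤′k) (≤-by-gap (p k) (0≤p k) refl)

p+p≤q+q⇒p≤q : ∀ {p q} → p + p ≤ q + q → p ≤ q
p+p≤q+q⇒p≤q {p} {q} 2p≤2q with p ≤? q
... | yes p≤q = p≤q
... | no p≰q = contradiction (+-mono-< (≰⇒> p≰q) (≰⇒> p≰q)) (≤⇒≯ 2p≤2q)

module _ {n : ℕ} (a : Fin n → ℚ) where

  pairSum : (Fin n → Fin n → ℚ) → ℚ
  pairSum f = ∑ λ j → a j * ∑ λ k → a k * f j k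

  private
    double : (Fin n → Fin n → ℚ) → ℚ
    double f = ∑ λ j → ∑ λ k → a j * (a k * f j k)

    pairSum≡double : ∀ f → pairSum f ≡ double f
    pairSum≡double f = sum-cong-≗ λ j → *-distribˡ-sum (a j) (λ k → a k * f j k)

    pairSum-symmetrise : ∀ f → pairSum f + pairSum f ≡ double (λ j k → f j k + f k j)
    pairSum-symmetrise f = begin
      pairSum f + pairSum f
        ≡⟨ cong₂ _+_ (pairSum≡double f) (trans (pairSum≡double f) (∑-comm (λ j k → a j * (a k * f j k)))) ⟩
      double f + ∑ (λ j → ∑ λ k → a k * (a j * f k j))
        ≡⟨ ∑-distrib-+ (λ j → ∑ λ k → a j * (a k * f j k)) (λ j → ∑ λ k → a k * (a j * f k j)) ⟨
      ∑ (λ j → ∑ (λ k → a j * (a k * f j k)) + ∑ (λ k → a k * (a j * f k j)))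
        ≡⟨ sum-cong-≗ (λ j → trans (sym (∑-distrib-+ (λ k → a j * (a k * f j k)) (λ k → a k * (a j * f k j))))
             (sum-cong-≗ λ k → solve 4 (λ x y u v → x :* (y :* u) :+ y :* (x :* v) := x :* (y :* (u :+ v))) refl (a j) (a k) (f j k) (f k j))) ⟩
      double (λ j k → f j k + f k j) ∎
      where open ≡-Reasoning

  -- Exchanging the two summation indices shows that twice the form depends only on `f j k + f k j`,
  -- so a comparison for each pair of jobs is enough.
  pairSum-mono : (∀ j → 0ℚ ≤ a j) → ∀ {f g} → (∀ j k → f j k + f k j ≤ g j k + g k j) → pairSum f ≤ pairSum g
  pairSum-mono 0≤a {f} {g} f≤g = p+p≤q+q⇒p≤q (subst₂ _≤_ (sym (pairSum-symmetrise f)) (sym (pairSum-symmetrise g))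
    (∑-mono λ j → ∑-mono λ k → *-monoˡ-≤ (0≤a j) (*-monoˡ-≤ (0≤a k) (f≤g j k))))

-- Integrals of step functions

module _ {n : ℕ} (π : Piece n) (πs : List (Piece n)) (j : Fin n) {t : ℚ} where

  rateAt-< : t < duration π → rateAt (π ∷ πs) j t ≡ rates π j
  rateAt-< t<d = cong (λ b → if b then rates π j else rateAt πs j (t - duration π)) (dec-true (t <? duration π) t<d)

  rateAt-≥ : duration π ≤ t → rateAt (π ∷ πs) j t ≡ rateAt πs j (t - duration π)
  rateAt-≥ d≤t = cong (λ b → if b then rates π j else rateAt πs j (t - duration π)) (dec-false (t <? duration π) (≤⇒≯ d≤t))

  cumulative-< : t < duration π → cumulative (π ∷ πs) j t ≡ rates π j * t
  cumulative-< t<d =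
    cong (λ b → if b then rates π j * t else rates π j * duration π + cumulative πs j (t - duration π)) (dec-true (t <? duration π) t<d)

  cumulative-≥ : duration π ≤ t →
                 cumulative (π ∷ πs) j t ≡ rates π j * duration π + cumulative πs j (t - duration π)
  cumulative-≥ d≤t =
    cong (λ b → if b then rates π j * t else rates π j * duration π + cumulative πs j (t - duration π)) (dec-false (t <? duration π) (≤⇒≯ d≤t))

cumulative-0 : ∀ {n} {πs : List (Piece n)} → All (λ π → 0ℚ ≤ duration π) πs → ∀ j → cumulative πs j 0ℚ ≡ 0ℚ
cumulative-0 {πs = []} [] j = refl
cumulative-0 {πs = π ∷ πs} (0≤d ∷ ds) j with 0ℚ <? duration π
... | yes 0<d = trans (cumulative-< π πs j 0<d) (*-zeroʳ (rates π j))
... | no 0≮d = begin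
  cumulative (π ∷ πs) j 0ℚ                               ≡⟨ cumulative-≥ π πs j d≤0 ⟩
  rates π j * duration π + cumulative πs j (0ℚ - duration π)  ≡⟨ cong (λ d → rates π j * d + cumulative πs j (0ℚ - d)) (≤-antisym d≤0 0≤d) ⟩
  rates π j * 0ℚ + cumulative πs j 0ℚ                    ≡⟨ cong₂ _+_ (*-zeroʳ (rates π j)) (cumulative-0 ds j) ⟩
  0ℚ                                                     ∎
  where
  open ≡-Reasoning
  d≤0 = ≮⇒≥ 0≮d

-- Lets a single induction over the pieces cover the rate of one job, its negative (for lower
-- bounds) and weighted total rates.
record LinearForm (n : ℕ) : Set where
  field
    ⟪_⟫    : (Fin n → ℚ) → ℚ
    ⟪⟫-cong : ∀ {f g} → (∀ j → f j ≡ g j) → ⟪ f ⟫ ≡ ⟪ g ⟫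
    ⟪⟫-+    : ∀ f g → ⟪ (λ j → f j + g j) ⟫ ≡ ⟪ f ⟫ + ⟪ g ⟫
    ⟪⟫-*    : ∀ f c → ⟪ (λ j → f j * c) ⟫ ≡ ⟪ f ⟫ * c

  ⟪⟫-0 : ⟪ (λ _ → 0ℚ) ⟫ ≡ 0ℚ
  ⟪⟫-0 = trans (⟪⟫-* (λ _ → 0ℚ) 0ℚ) (*-zeroʳ ⟪ (λ _ → 0ℚ) ⟫)

open LinearForm

evaluation : ∀ {n} → Fin n → LinearForm n
evaluation j = record
  { ⟪_⟫ = λ f → f j ; ⟪⟫-cong = λ f≗g → f≗g j ; ⟪⟫-+ = λ _ _ → refl ; ⟪⟫-* = λ _ _ → refl }

negated : ∀ {n} → LinearForm n → LinearForm n
negated L = record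
  { ⟪_⟫ = λ f → - ⟪ L ⟫ f
  ; ⟪⟫-cong = λ f≗g → cong -_ (⟪⟫-cong L f≗g)
  ; ⟪⟫-+ = λ f g → trans (cong -_ (⟪⟫-+ L f g)) (neg-distrib-+ (⟪ L ⟫ f) (⟪ L ⟫ g))
  ; ⟪⟫-* = λ f c → trans (cong -_ (⟪⟫-* L f c)) (neg-distribˡ-* (⟪ L ⟫ f) c)
  }

weightedSum : ∀ {n} → (Fin n → ℚ) → LinearForm n
weightedSum w = record
  { ⟪_⟫ = λ f → ∑ (λ j → w j * f j)
  ; ⟪⟫-cong = λ f≗g → sum-cong-≗ (λ j → cong (w j *_) (f≗g j))
  ; ⟪⟫-+ = λ f g → trans (sum-cong-≗ (λ j → *-distribˡ-+ (w j) (f j) (g j))) (∑-distrib-+ (λ j → w j * f j) (λ j → w j * g j))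
  ; ⟪⟫-* = λ f c → trans (sum-cong-≗ (λ j → sym (*-assoc (w j) (f j) c))) (sym (*-distribʳ-sum c (λ j → w j * f j)))
  }

module _ {n : ℕ} (L : LinearForm n) (c : ℚ) where

  private
    RateBound : List (Piece n) → ℚ → ℚ → Set
    RateBound πs a b = ∀ t → a ≤ t → t < b → ⟪ L ⟫ (λ j → rateAt πs j t) ≤ c

    tail-bound : ∀ π {πs a b} → 0ℚ ≤ a → RateBound (π ∷ πs) (a + duration π) b → RateBound πs a (b - duration π)
    tail-bound π {πs} {a} {b} 0≤a bound t a≤t t<b-d =
      subst (_≤ c) (⟪⟫-cong L λ j → trans (rateAt-≥ π πs j d≤t+d) (cong (rateAt πs j) (solve 2 (λ t d → t :+ d :- d := t) refl t d)))
        (bound (t + d) (+-monoˡ-≤ d a≤t) t+d<b)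
      where
      d = duration π
      d≤t+d : d ≤ t + d
      d≤t+d = ≤-by-gap t (≤-trans 0≤a a≤t) (+-comm t d)
      t+d<b : t + d < b
      t+d<b = subst (t + d <_) (solve 2 (λ b d → b :- d :+ d := b) refl b d) (+-monoˡ-< d t<b-d)

    -- Since `a < b`, the rate bound applies at `a` itself, which controls the piece containing `a`,
    -- or gives `0 ≤ c` after the last piece. On an empty interval the bound says nothing;
    -- `integral-≤` treats that case.
    integral-≤-< : ∀ {πs} → All (λ π → 0ℚ ≤ duration π) πs → ∀ {a b} → 0ℚ ≤ a → a < b →
                   RateBound πs a b → ⟪ L ⟫ (λ j → integral πs j a b) ≤ c * (b - a)

  integral-≤ : ∀ {πs} → All (λ π → 0ℚ ≤ duration π) πs → ∀ {a b} → 0ℚ ≤ a → a ≤ b →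
               RateBound πs a b → ⟪ L ⟫ (λ j → integral πs j a b) ≤ c * (b - a)
  integral-≤ {πs} ds {a} {b} 0≤a a≤b bound with a <? b
  ... | yes a<b = integral-≤-< ds 0≤a a<b bound
  ... | no a≮b with ≤-antisym a≤b (≮⇒≥ a≮b)
  ...   | refl = ≤-reflexive (begin
    ⟪ L ⟫ (λ j → integral πs j a a)  ≡⟨ ⟪⟫-cong L (λ j → +-inverseʳ (cumulative πs j a)) ⟩
    ⟪ L ⟫ (λ j → 0ℚ)                 ≡⟨ ⟪⟫-0 L ⟩
    0ℚ                               ≡⟨ solve 2 (λ c a → con 0ℚ := c :* (a :- a)) refl c a ⟩
    c * (a - a)                      ∎)
    where open ≡-Reasoning

  integral-≤-< {[]} [] {a} {b} 0≤a a<b bound = begin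
    ⟪ L ⟫ (λ j → 0ℚ - 0ℚ)  ≡⟨ ⟪⟫-cong L (λ j → +-inverseʳ 0ℚ) ⟩
    ⟪ L ⟫ (λ j → 0ℚ)       ≡⟨ ⟪⟫-0 L ⟩
    0ℚ                     ≤⟨ 0≤p*q (subst (_≤ c) (⟪⟫-0 L) (bound a ≤-refl a<b)) (p≤q⇒0≤q-p (<⇒≤ a<b)) ⟩
    c * (b - a)            ∎
    where open ≤-Reasoning
  integral-≤-< {π ∷ πs} (0≤d ∷ ds) {a} {b} 0≤a a<b bound with b <? duration π | a <? duration π
  ... | yes b<d | _ = begin
    ⟪ L ⟫ (λ j → integral (π ∷ πs) j a b)  ≡⟨ ⟪⟫-cong L (λ j → trans (cong₂ _-_ (cumulative-< π πs j b<d) (cumulative-< π πs j a<d)) (solve 3 (λ r a b → r :* b :- r :* a := r :* (b :- a)) refl (rates π j) a b)) ⟩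
    ⟪ L ⟫ (λ j → rates π j * (b - a))      ≡⟨ ⟪⟫-* L (rates π) (b - a) ⟩
    ⟪ L ⟫ (rates π) * (b - a)              ≤⟨ *-monoʳ-≤ (p≤q⇒0≤q-p (<⇒≤ a<b)) (subst (_≤ c) (⟪⟫-cong L (λ j → rateAt-< π πs j a<d)) (bound a ≤-refl a<b)) ⟩
    c * (b - a)                            ∎
    where
    open ≤-Reasoning
    a<d = <-trans a<b b<d
  ... | no b≮d | yes a<d = begin
    ⟪ L ⟫ (λ j → integral (π ∷ πs) j a b)
      ≡⟨ ⟪⟫-cong L (λ j → trans (cong₂ _-_ (cumulative-≥ π πs j d≤b) (cumulative-< π πs j a<d))
           (trans (solve 4 (λ r a d y → r :* d :+ y :- r :* a := r :* (d :- a) :+ (y :- con 0ℚ)) refl (rates π j) a d (cumulative πs j (b - d)))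
             -- The subtracted 0 is the cumulative work at time 0 of the tail, which turns the
             -- second summand into an integral from 0.
             (cong (λ z → rates π j * (d - a) + (cumulative πs j (b - d) - z)) (sym (cumulative-0 ds j))))) ⟩
    ⟪ L ⟫ (λ j → rates π j * (d - a) + integral πs j 0ℚ (b - d))
      ≡⟨ ⟪⟫-+ L (λ j → rates π j * (d - a)) (λ j → integral πs j 0ℚ (b - d)) ⟩
    ⟪ L ⟫ (λ j → rates π j * (d - a)) + ⟪ L ⟫ (λ j → integral πs j 0ℚ (b - d))
      ≤⟨ +-mono-≤ head-≤ (integral-≤ ds ≤-refl (p≤q⇒0≤q-p d≤b)
           (tail-bound π {πs} ≤-refl (λ t 0+d≤t → bound t (≤-trans (<⇒≤ a<d) (subst (_≤ t) (+-identityˡ d) 0+d≤t))))) ⟩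
    c * (d - a) + c * (b - d - 0ℚ)
      ≡⟨ solve 4 (λ c a b d → c :* (d :- a) :+ c :* (b :- d :- con 0ℚ) := c :* (b :- a)) refl c a b d ⟩
    c * (b - a) ∎
    where
    open ≤-Reasoning
    d = duration π
    d≤b = ≮⇒≥ b≮d
    head-≤ : ⟪ L ⟫ (λ j → rates π j * (d - a)) ≤ c * (d - a)
    head-≤ = subst (_≤ c * (d - a)) (sym (⟪⟫-* L (rates π) (d - a)))
      (*-monoʳ-≤ (p≤q⇒0≤q-p (<⇒≤ a<d)) (subst (_≤ c) (⟪⟫-cong L (λ j → rateAt-< π πs j a<d)) (bound a ≤-refl a<b)))
  ... | no b≮d | no a≮d = begin
    ⟪ L ⟫ (λ j → integral (π ∷ πs) j a b)
      ≡⟨ ⟪⟫-cong L (λ j → trans (cong₂ _-_ (cumulative-≥ π πs j d≤b) (cumulative-≥ π πs j d≤a))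
           (solve 3 (λ r x y → r :+ x :- (r :+ y) := x :- y) refl (rates π j * d) (cumulative πs j (b - d)) (cumulative πs j (a - d)))) ⟩
    ⟪ L ⟫ (λ j → integral πs j (a - d) (b - d))
      ≤⟨ integral-≤ ds (p≤q⇒0≤q-p d≤a) (+-monoˡ-≤ (- d) (<⇒≤ a<b))
           (tail-bound π {πs} (p≤q⇒0≤q-p d≤a) (λ t a≤t → bound t (subst (_≤ t) (solve 2 (λ a d → a :- d :+ d := a) refl a d) a≤t))) ⟩
    c * (b - d - (a - d))
      ≡⟨ solve 4 (λ c a b d → c :* (b :- d :- (a :- d)) := c :* (b :- a)) refl c a b d ⟩
    c * (b - a) ∎
    where
    open ≤-Reasoning
    d = duration π
    d≤a = ≮⇒≥ a≮d
    d≤b = ≮⇒≥ b≮d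

integral-≥ : ∀ {n} (L : LinearForm n) c {πs} → All (λ π → 0ℚ ≤ duration π) πs → ∀ {a b} → 0ℚ ≤ a → a ≤ b →
             (∀ t → a ≤ t → t < b → c ≤ ⟪ L ⟫ (λ j → rateAt πs j t)) →
             c * (b - a) ≤ ⟪ L ⟫ (λ j → integral πs j a b)
integral-≥ L c {πs} ds {a} {b} 0≤a a≤b bound =
  subst₂ _≤_ (solve 3 (λ c a b → :- (:- c :* (b :- a)) := c :* (b :- a)) refl c a b) (neg-involutive _)
    (neg-antimono-≤ (integral-≤ (negated L) (- c) ds 0≤a a≤b (λ t a≤t t<b → neg-antimono-≤ (bound t a≤t t<b))))
  where
  neg-involutive : ∀ p → - - p ≡ p
  neg-involutive = solve 1 (λ p → :- (:- p) := p) refl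

integral-split : ∀ {n} (πs : List (Piece n)) j a b c → integral πs j a c ≡ integral πs j a b + integral πs j b c
integral-split πs j a b c =
  solve 3 (λ x y z → z :- x := y :- x :+ (z :- y)) refl (cumulative πs j a) (cumulative πs j b) (cumulative πs j c)

-- A criterion for optimality

module _ {I : Instance} (S : Schedule I) where
  open Instance I
  open Schedule S

  cumulative-mono : ∀ j {a b} → 0ℚ ≤ a → a ≤ b → cumulative pieces j a ≤ cumulative pieces j b
  cumulative-mono j {a} {b} 0≤a a≤b = ≤-by-gap (integral pieces j a b)
    (subst (_≤ integral pieces j a b) (*-zeroˡ (b - a))
      (integral-≥ (evaluation j) 0ℚ duration≥0 0≤a a≤b (λ t a≤t _ → rate≥0 j t (≤-trans 0≤a a≤t))))
    (solve 2 (λ x y → y := x :+ (y :- x)) refl (cumulative pieces j a) (cumulative pieces j b))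

  integral-capacity : ∀ {w} → (∀ j → w j ≤ 1ℚ) → ∀ {a b} → 0ℚ ≤ a → a ≤ b → ∑ (λ j → w j * integral pieces j a b) ≤ b - a
  integral-capacity {w} w≤1 {a} {b} 0≤a a≤b = subst (∑ (λ j → w j * integral pieces j a b) ≤_) (*-identityˡ (b - a))
    (integral-≤ (weightedSum w) 1ℚ duration≥0 0≤a a≤b λ t a≤t _ → begin
      ∑ (λ j → w j * rate j t)  ≤⟨ ∑-mono (λ j → *-monoʳ-≤ (rate≥0 j t (≤-trans 0≤a a≤t)) (w≤1 j)) ⟩
      ∑ (λ j → 1ℚ * rate j t)   ≡⟨ sum-cong-≗ (λ j → *-identityˡ (rate j t)) ⟩
      ∑ (λ j → rate j t)        ≤⟨ capacity t (≤-trans 0≤a a≤t) ⟩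
      1ℚ                        ∎)
    where open ≤-Reasoning

  processed-≤ : ∀ j {r c} → 0ℚ ≤ r → r ≤ release j → completion j ≤ c → size j ≤ integral pieces j r c
  processed-≤ j {r} {c} 0≤r r≤rj Cj≤c = begin
    size j                                          ≤⟨ processed j ⟩
    integral pieces j (release j) (completion j)    ≤⟨ +-mono-≤ (cumulative-mono j (≤-trans (release≥0 j) (release≤complete j)) Cj≤c)
                                                         (neg-antimono-≤ (cumulative-mono j 0≤r r≤rj)) ⟩
    integral pieces j r c                           ∎
    where open ≤-Reasoning

  -- Each member of `B` completed no later than `j` is processed entirely between `r` and the
  -- completion of `j`, and the machine can do at most that much work there. The product of the two
  -- indicators selects these jobs.
  completion-≥ : ∀ {B : Fin jobs → Set} (B? : ∀ k → Dec (B k)) {r} → 0ℚ ≤ r → (∀ k → B k → r ≤ release k) →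
                 ∀ j → B j →
                 r + ∑ (λ k → 𝟙 (B? k) * size k * 𝟙 (completion k ≤? completion j)) ≤ completion j
  completion-≥ {B} B? {r} 0≤r r≤release j Bj = begin
    r + ∑ (λ k → 𝟙 (B? k) * size k * 𝟙 (completion k ≤? c))
      ≤⟨ +-monoʳ-≤ r (∑-mono work) ⟩
    r + ∑ (λ k → (𝟙 (B? k) * 𝟙 (completion k ≤? c)) * integral pieces k r c)
      ≤⟨ +-monoʳ-≤ r (integral-capacity w≤1 0≤r (≤-trans (r≤release j Bj) (release≤complete j))) ⟩
    r + (c - r)
      ≡⟨ solve 2 (λ r c → r :+ (c :- r) := c) refl r c ⟩
    c ∎
    where
    open ≤-Reasoning
    c = completion j

    w≤1 : ∀ k → 𝟙 (B? k) * 𝟙 (completion k ≤? c) ≤ 1ℚ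
    w≤1 k = ≤-trans (*-monoʳ-≤ (0≤𝟙 (completion k ≤? c)) (𝟙≤1 (B? k)))
      (subst (_≤ 1ℚ) (sym (*-identityˡ _)) (𝟙≤1 (completion k ≤? c)))

    work : ∀ k → 𝟙 (B? k) * size k * 𝟙 (completion k ≤? c) ≤ (𝟙 (B? k) * 𝟙 (completion k ≤? c)) * integral pieces k r c
    work k = subst (_≤ (𝟙 (B? k) * 𝟙 (completion k ≤? c)) * integral pieces k r c)
      (solve 3 (λ x y z → x :* y :* z := x :* z :* y) refl (𝟙 (B? k)) (𝟙 (completion k ≤? c)) (size k)) (bound (B? k) (completion k ≤? c))
      where
      -- With both decisions generalised the indicators compute; unless both hold, both sides
      -- vanish.
      bound : (B? : Dec (B k)) (C? : Dec (completion k ≤ c)) → 𝟙 B? * 𝟙 C? * size k ≤ 𝟙 B? * 𝟙 C? * integral pieces k r c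
      bound (yes Bk) (yes Ck≤c) = *-monoˡ-≤ (nonNegative⁻¹ (1ℚ * 1ℚ)) (processed-≤ k 0≤r (r≤release k Bk) Ck≤c)
      bound (yes _) (no _) = ≤-reflexive (trans (*-zeroˡ (size k)) (sym (*-zeroˡ (integral pieces k r c))))
      bound (no _) (yes _) = ≤-reflexive (trans (*-zeroˡ (size k)) (sym (*-zeroˡ (integral pieces k r c))))
      bound (no _) (no _) = ≤-reflexive (trans (*-zeroˡ (size k)) (sym (*-zeroˡ (integral pieces k r c))))

1≤𝟙-total : ∀ p q → 1ℚ ≤ 𝟙 (p ≤? q) + 𝟙 (q ≤? p)
1≤𝟙-total p q with ≤-total p q
... | inj₁ p≤q = ≤-by-gap (𝟙 (q ≤? p)) (0≤𝟙 (q ≤? p)) (cong (_+ 𝟙 (q ≤? p)) (𝟙-true (p ≤? q) p≤q))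
... | inj₂ q≤p = ≤-by-gap (𝟙 (p ≤? q)) (0≤𝟙 (p ≤? q)) (trans (+-comm (𝟙 (p ≤? q)) (𝟙 (q ≤? p))) (cong (_+ 𝟙 (p ≤? q)) (𝟙-true (q ≤? p) q≤p)))

-- The numbering has no ties, so it counts exactly one direction of each pair of distinct jobs.
-- Completion times count at least one direction, and both in a tie.
rank-pair-≤ : ∀ {n} (c : Fin n → ℚ) j k →
  𝟙 (toℕ k ℕP.≤? toℕ j) + 𝟙 (toℕ j ℕP.≤? toℕ k) ≤ 𝟙 (c k ≤? c j) + 𝟙 (c j ≤? c k)
rank-pair-≤ c j k with ℕP.<-cmp (toℕ j) (toℕ k)
... | tri< j<k _ _ = ≤-trans
  (+-mono-≤ (≤-reflexive (𝟙-false (toℕ k ℕP.≤? toℕ j) (ℕP.<⇒≱ j<k))) (𝟙≤1 (toℕ j ℕP.≤? toℕ k)))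
  (1≤𝟙-total (c k) (c j))
... | tri> _ _ k<j = ≤-trans
  (+-mono-≤ (𝟙≤1 (toℕ k ℕP.≤? toℕ j)) (≤-reflexive (𝟙-false (toℕ j ℕP.≤? toℕ k) (ℕP.<⇒≱ k<j))))
  (1≤𝟙-total (c k) (c j))
... | tri≈ _ j≡k _ with FinP.toℕ-injective j≡k
...   | refl = +-mono-≤ (𝟙≤𝟙-refl (𝟙≤1 (toℕ j ℕP.≤? toℕ j))) (𝟙≤𝟙-refl (𝟙≤1 (toℕ j ℕP.≤? toℕ j)))
  where
  𝟙≤𝟙-refl : ∀ {p} → p ≤ 1ℚ → p ≤ 𝟙 (c j ≤? c j)
  𝟙≤𝟙-refl p≤1 = ≤-trans p≤1 (≤-reflexive (sym (𝟙-true (c j ≤? c j) ≤-refl)))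

module _ {n : ℕ} (level : Fin n → ℕ) (x : Fin n → ℚ)
         (0≤upper : ∀ i → 0ℚ ≤ ∑ (λ j → 𝟙 (i ℕP.≤? level j) * x j))
         {v : ℕ → ℚ} (0≤v₀ : 0ℚ ≤ v 0) (v-mono : ∀ i → v i ≤ v (suc i)) where

  private
    -- Lifting the cap from `i` to `suc i` changes the weight exactly for levels above `i`, and by
    -- the same increment for all of them.
    raise : ∀ i ℓ → v (ℓ ℕ.⊓ suc i) ≡ v (ℓ ℕ.⊓ i) + (v (suc i) - v i) * 𝟙 (suc i ℕP.≤? ℓ)
    raise i ℓ with ℕP.≤-<-connex (suc i) ℓ
    ... | inj₁ i<ℓ = begin
      v (ℓ ℕ.⊓ suc i)                                               ≡⟨ cong v (ℕP.m≥n⇒m⊓n≡n i<ℓ) ⟩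
      v (suc i)                                                     ≡⟨ solve 2 (λ p q → q := p :+ (q :- p) :* con 1ℚ) refl (v i) (v (suc i)) ⟩
      v i + (v (suc i) - v i) * 1ℚ                                  ≡⟨ cong₂ (λ k z → v k + (v (suc i) - v i) * z) (ℕP.m≥n⇒m⊓n≡n (ℕP.<⇒≤ i<ℓ)) (𝟙-true (suc i ℕP.≤? ℓ) i<ℓ) ⟨
      v (ℓ ℕ.⊓ i) + (v (suc i) - v i) * 𝟙 (suc i ℕP.≤? ℓ)           ∎
      where open ≡-Reasoning
    ... | inj₂ (ℕ.s≤s ℓ≤i) = begin
      v (ℓ ℕ.⊓ suc i)                                               ≡⟨ cong v (ℕP.m≤n⇒m⊓n≡m (ℕP.m≤n⇒m≤1+n ℓ≤i)) ⟩
      v ℓ                                                           ≡⟨ solve 3 (λ p q r → r := r :+ (q :- p) :* con 0ℚ) refl (v i) (v (suc i)) (v ℓ) ⟩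
      v ℓ + (v (suc i) - v i) * 0ℚ                                  ≡⟨ cong₂ (λ k z → v k + (v (suc i) - v i) * z) (ℕP.m≤n⇒m⊓n≡m ℓ≤i) (𝟙-false (suc i ℕP.≤? ℓ) (ℕP.≤⇒≯ ℓ≤i)) ⟨
      v (ℓ ℕ.⊓ i) + (v (suc i) - v i) * 𝟙 (suc i ℕP.≤? ℓ)           ∎
      where open ≡-Reasoning

  -- Abel summation: the weights v (level j ⊓ i) are built up from v 0 one level at a time.
  abel : ∀ i → 0ℚ ≤ ∑ (λ j → v (level j ℕ.⊓ i) * x j)
  abel zero = subst (0ℚ ≤_) (begin
    v 0 * ∑ (λ j → 𝟙 (0 ℕP.≤? level j) * x j)      ≡⟨ *-distribˡ-sum (v 0) (λ j → 𝟙 (0 ℕP.≤? level j) * x j) ⟩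
    ∑ (λ j → v 0 * (𝟙 (0 ℕP.≤? level j) * x j))    ≡⟨ sum-cong-≗ (λ j → cong₂ (λ k z → v k * z) (sym (ℕP.⊓-zeroʳ (level j)))
                                                       (trans (cong (_* x j) (𝟙-true (0 ℕP.≤? level j) ℕ.z≤n)) (*-identityˡ (x j)))) ⟩
    ∑ (λ j → v (level j ℕ.⊓ 0) * x j)              ∎)
    (0≤p*q 0≤v₀ (0≤upper 0))
    where open ≡-Reasoning
  abel (suc i) = subst (0ℚ ≤_) (begin
    ∑ (λ j → v (level j ℕ.⊓ i) * x j) + δ * ∑ (λ j → 𝟙 (suc i ℕP.≤? level j) * x j)
      ≡⟨ cong (_+_ (∑ λ j → v (level j ℕ.⊓ i) * x j)) (*-distribˡ-sum δ (λ j → 𝟙 (suc i ℕP.≤? level j) * x j)) ⟩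
    ∑ (λ j → v (level j ℕ.⊓ i) * x j) + ∑ (λ j → δ * (𝟙 (suc i ℕP.≤? level j) * x j))
      ≡⟨ ∑-distrib-+ (λ j → v (level j ℕ.⊓ i) * x j) (λ j → δ * (𝟙 (suc i ℕP.≤? level j) * x j)) ⟨
    ∑ (λ j → v (level j ℕ.⊓ i) * x j + δ * (𝟙 (suc i ℕP.≤? level j) * x j))
      ≡⟨ sum-cong-≗ (λ j → trans
           (solve 4 (λ p d z x → p :* x :+ d :* (z :* x) := (p :+ d :* z) :* x) refl (v (level j ℕ.⊓ i)) δ (𝟙 (suc i ℕP.≤? level j)) (x j))
           (cong (_* x j) (sym (raise i (level j))))) ⟩
    ∑ (λ j → v (level j ℕ.⊓ suc i) * x j) ∎)
    (0≤p+q (abel i) (0≤p*q (p≤q⇒0≤q-p (v-mono i)) (0≤upper (suc i))))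
    where
    open ≡-Reasoning
    δ = v (suc i) - v i

module _ {I : Instance} (S : Schedule I) where
  open Instance I
  open Schedule

  -- Here `v` is the reciprocal size as a function of the level. The last hypothesis says that, from
  -- `r i` on, `S` works only on levels at least `i` and in index order, until the last such job is
  -- done. Hence each upper family has minimal size-weighted completion time, and `abel` combines
  -- the families into the unweighted sum.
  nested-optimal :
    (level : Fin jobs → ℕ) (top : ℕ) → (∀ j → level j ℕ.≤ top) →
    (v : ℕ → ℚ) → 0ℚ ≤ v 0 → (∀ i → v i ≤ v (suc i)) → (∀ j → v (level j) * size j ≡ 1ℚ) →
    (r : ℕ → ℚ) → (∀ i → 0ℚ ≤ r i) → (∀ i j → i ℕ.≤ level j → r i ≤ release j) →
    (∀ i j → i ℕ.≤ level j →
      completion S j ≤ r i + ∑ (λ k → 𝟙 (i ℕP.≤? level k) * size k * 𝟙 (toℕ k ℕP.≤? toℕ j))) →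
    IsOptimal S
  nested-optimal level top level≤top v 0≤v₀ v-mono v*size r 0≤r r≤release consecutive S′ =
    ≤-by-gap (∑ (λ j → completion S′ j - completion S j))
      (subst (0ℚ ≤_) (sum-cong-≗ unweighted) (abel level x 0≤upper 0≤v₀ v-mono top))
      (let open ≡-Reasoning in begin
        ∑ (completion S′)                                          ≡⟨ solve 2 (λ p q → q := p :+ (q :- p)) refl (∑ (completion S)) (∑ (completion S′)) ⟩
        ∑ (completion S) + (∑ (completion S′) - ∑ (completion S))  ≡⟨ cong (_+_ (∑ (completion S))) (∑-distrib-- (completion S′) (completion S)) ⟨
        ∑ (completion S) + ∑ (λ j → completion S′ j - completion S j) ∎)
    where
    x : Fin jobs → ℚ
    x j = size j * (completion S′ j - completion S j)

    unweighted : ∀ j → v (level j ℕ.⊓ top) * x j ≡ completion S′ j - completion S j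
    unweighted j = begin
      v (level j ℕ.⊓ top) * x j        ≡⟨ cong (λ k → v k * x j) (ℕP.m≤n⇒m⊓n≡m (level≤top j)) ⟩
      v (level j) * (size j * Δ)       ≡⟨ *-assoc (v (level j)) (size j) Δ ⟨
      v (level j) * size j * Δ         ≡⟨ cong (_* Δ) (v*size j) ⟩
      1ℚ * Δ                           ≡⟨ *-identityˡ Δ ⟩
      Δ                                ∎
      where
      open ≡-Reasoning
      Δ = completion S′ j - completion S j

    module _ (i : ℕ) where
      a : Fin jobs → ℚ
      a j = 𝟙 (i ℕP.≤? level j) * size j

      0≤a : ∀ j → 0ℚ ≤ a j
      0≤a j = 0≤p*q (0≤𝟙 (i ℕP.≤? level j)) (<⇒≤ (size>0 j))

      byIndex byCompletion : Fin jobs → Fin jobs → ℚ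
      byIndex j k = 𝟙 (toℕ k ℕP.≤? toℕ j)
      byCompletion j k = 𝟙 (completion S′ k ≤? completion S′ j)

      -- Jobs below level `i` have weight 0, so the comparison is needed only inside the family.
      a*-mono : ∀ {p q} j → (i ℕ.≤ level j → p ≤ q) → a j * p ≤ a j * q
      a*-mono {p} {q} j p≤q = helper (i ℕP.≤? level j)
        where
        helper : (d : Dec (i ℕ.≤ level j)) → 𝟙 d * size j * p ≤ 𝟙 d * size j * q
        helper (yes i≤ℓ) = *-monoˡ-≤ (0≤p*q (nonNegative⁻¹ 1ℚ) (<⇒≤ (size>0 j))) (p≤q i≤ℓ)
        helper (no _) = ≤-reflexive (solve 3 (λ s p q → con 0ℚ :* s :* p := con 0ℚ :* s :* q) refl (size j) p q)

      expand : ∀ f → ∑ (λ j → a j * (r i + ∑ (λ k → a k * f j k))) ≡ ∑ (λ j → a j * r i) + pairSum a f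
      expand f = trans (sum-cong-≗ λ j → *-distribˡ-+ (a j) (r i) (∑ (λ k → a k * f j k)))
        (∑-distrib-+ (λ j → a j * r i) (λ j → a j * ∑ (λ k → a k * f j k)))

      upper-≤ : ∑ (λ j → a j * completion S j) ≤ ∑ (λ j → a j * completion S′ j)
      upper-≤ = begin
        ∑ (λ j → a j * completion S j)
          ≤⟨ ∑-mono (λ j → a*-mono j (consecutive i j)) ⟩
        ∑ (λ j → a j * (r i + ∑ (λ k → a k * byIndex j k)))
          ≡⟨ expand byIndex ⟩
        ∑ (λ j → a j * r i) + pairSum a byIndex
          -- The exchange step: the index order of `S` is replaced by the order in which `S′`
          -- completes the jobs.
          ≤⟨ +-monoʳ-≤ (∑ (λ j → a j * r i)) (pairSum-mono a 0≤a (rank-pair-≤ (completion S′))) ⟩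
        ∑ (λ j → a j * r i) + pairSum a byCompletion
          ≡⟨ expand byCompletion ⟨
        ∑ (λ j → a j * (r i + ∑ (λ k → a k * byCompletion j k)))
          ≤⟨ ∑-mono (λ j → a*-mono j (completion-≥ S′ (λ k → i ℕP.≤? level k) (0≤r i) (r≤release i) j)) ⟩
        ∑ (λ j → a j * completion S′ j) ∎
        where open ≤-Reasoning

      0≤upper : 0ℚ ≤ ∑ (λ j → 𝟙 (i ℕP.≤? level j) * x j)
      0≤upper = subst (0ℚ ≤_) (begin
        ∑ (λ j → a j * completion S′ j) - ∑ (λ j → a j * completion S j)
          ≡⟨ ∑-distrib-- (λ j → a j * completion S′ j) (λ j → a j * completion S j) ⟨
        ∑ (λ j → a j * completion S′ j - a j * completion S j)
          ≡⟨ sum-cong-≗ (λ j → solve 4 (λ z s p q → z :* s :* q :- z :* s :* p := z :* (s :* (q :- p))) refl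
               (𝟙 (i ℕP.≤? level j)) (size j) (completion S j) (completion S′ j)) ⟩
        ∑ (λ j → 𝟙 (i ℕP.≤? level j) * x j) ∎)
        (p≤q⇒0≤q-p upper-≤)
        where open ≡-Reasoning

-- Sequential and Round-Robin schedules

module Segments {n : ℕ} (τ : ℕ → ℚ) (τ-mono : ∀ i → τ i ≤ τ (suc i)) (R : ℕ → Fin n → ℚ) where

  -- Rates `R i` on the interval from `τ i` to `τ (suc i)`, for `m` consecutive values of `i` from
  -- `s` on. The list has its own clock, whose time 0 is `τ s`; hence the arguments `t - τ s` below.
  segments : ℕ → ℕ → List (Piece n)
  segments s zero    = []
  segments s (suc m) = piece (τ (suc s) - τ s) (R s) ∷ segments (suc s) m

  segments-duration≥0 : ∀ s m → All (λ π → 0ℚ ≤ duration π) (segments s m)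
  segments-duration≥0 s zero    = []
  segments-duration≥0 s (suc m) = p≤q⇒0≤q-p (τ-mono s) ∷ segments-duration≥0 (suc s) m

  τ-mono-≤ : ∀ {i k} → i ℕ.≤ k → τ i ≤ τ k
  τ-mono-≤ i≤k = go (ℕP.≤⇒≤′ i≤k)
    where
    go : ∀ {i k} → i ℕ.≤′ k → τ i ≤ τ k
    go ℕ.≤′-refl         = ≤-refl
    go (ℕ.≤′-step i≤′k) = ≤-trans (go i≤′k) (τ-mono _)

  private
    shift : ∀ s t → (t - τ s) - (τ (suc s) - τ s) ≡ t - τ (suc s)
    shift s t = solve 3 (λ t x y → t :- x :- (y :- x) := t :- y) refl t (τ s) (τ (suc s))

    past-first : ∀ s m j t → τ (suc s) ≤ t → rateAt (segments s (suc m)) j (t - τ s) ≡ rateAt (segments (suc s) m) j (t - τ (suc s))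
    past-first s m j t τ≤t = trans
      (rateAt-≥ (piece (τ (suc s) - τ s) (R s)) (segments (suc s) m) j (+-monoˡ-≤ (- τ s) τ≤t))
      (cong (rateAt (segments (suc s) m) j) (shift s t))

    rate-in : ∀ s m j {i t} → s ℕ.≤ i → i ℕ.< s ℕ.+ m → τ i ≤ t → t < τ (suc i) →
              rateAt (segments s m) j (t - τ s) ≡ R i j
    rate-in s zero    j s≤i i<s+m _ _ = contradiction s≤i (ℕP.<⇒≱ (subst (_ ℕ.<_) (ℕP.+-identityʳ s) i<s+m))
    rate-in s (suc m) j {i} {t} s≤i i<s+m τ≤t t<τ with ℕP.m≤n⇒m<n∨m≡n s≤i
    ... | inj₁ s<i = trans (past-first s m j t (≤-trans (τ-mono-≤ s<i) τ≤t))
                           (rate-in (suc s) m j s<i (subst (i ℕ.<_) (ℕP.+-suc s m) i<s+m) τ≤t t<τ)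
    ... | inj₂ refl = rateAt-< (piece (τ (suc s) - τ s) (R s)) (segments (suc s) m) j (+-monoˡ-< (- τ s) t<τ)

    rate-past : ∀ s m j {t} → τ (s ℕ.+ m) ≤ t → rateAt (segments s m) j (t - τ s) ≡ 0ℚ
    rate-past s zero    j τ≤t = refl
    rate-past s (suc m) j {t} τ≤t = trans (past-first s m j t (≤-trans (τ-mono-≤ (ℕP.m≤m+n (suc s) m)) τ≤t′)) (rate-past (suc s) m j τ≤t′)
      where
      τ≤t′ : τ (suc s ℕ.+ m) ≤ t
      τ≤t′ = subst (λ k → τ k ≤ t) (ℕP.+-suc s m) τ≤t

    locate-from : ∀ s m {t} → τ s ≤ t → (∃[ i ] i ℕ.< s ℕ.+ m × τ i ≤ t × t < τ (suc i)) ⊎ τ (s ℕ.+ m) ≤ t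
    locate-from s zero    {t} τ≤t = inj₂ (subst (λ k → τ k ≤ t) (sym (ℕP.+-identityʳ s)) τ≤t)
    locate-from s (suc m) {t} τ≤t with t <? τ (suc s)
    ... | yes t<τ = inj₁ (s , ℕP.m<m+n s (ℕ.s≤s ℕ.z≤n) , τ≤t , t<τ)
    ... | no t≮τ rewrite ℕP.+-suc s m = locate-from (suc s) m (≮⇒≥ t≮τ)

  module _ (τ₀ : τ 0 ≡ 0ℚ) (m : ℕ) where

    locate : ∀ {t} → 0ℚ ≤ t → (∃[ i ] i ℕ.< m × τ i ≤ t × t < τ (suc i)) ⊎ τ m ≤ t
    locate {t} 0≤t = locate-from 0 m (subst (_≤ t) (sym τ₀) 0≤t)

    private
      from-0 : ∀ t → t ≡ t - τ 0
      from-0 t = trans (sym (+-identityʳ t)) (cong (λ z → t - z) (sym τ₀))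

    rateAt-segments : ∀ j {i t} → i ℕ.< m → τ i ≤ t → t < τ (suc i) → rateAt (segments 0 m) j t ≡ R i j
    rateAt-segments j {t = t} i<m τ≤t t<τ = trans (cong (rateAt (segments 0 m) j) (from-0 t)) (rate-in 0 m j ℕ.z≤n i<m τ≤t t<τ)

    rateAt-after : ∀ j {t} → τ m ≤ t → rateAt (segments 0 m) j t ≡ 0ℚ
    rateAt-after j {t} τ≤t = trans (cong (rateAt (segments 0 m) j) (from-0 t)) (rate-past 0 m j τ≤t)

    rateAt-cases : (Φ : ℚ → Set) (j : Fin n) {t : ℚ} → 0ℚ ≤ t →
                   (∀ i → i ℕ.< m → τ i ≤ t → t < τ (suc i) → Φ (R i j)) → Φ 0ℚ → Φ (rateAt (segments 0 m) j t)
    rateAt-cases Φ j 0≤t in-segment after with locate 0≤t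
    ... | inj₁ (i , i<m , τ≤t , t<τ) = subst Φ (sym (rateAt-segments j i<m τ≤t t<τ)) (in-segment i i<m τ≤t t<τ)
    ... | inj₂ τ≤t = subst Φ (sym (rateAt-after j τ≤t)) after

    ∑-rateAt-≤1 : (∀ i → i ℕ.< m → ∑ (R i) ≤ 1ℚ) → ∀ {t} → 0ℚ ≤ t → ∑ (λ j → rateAt (segments 0 m) j t) ≤ 1ℚ
    ∑-rateAt-≤1 ∑R≤1 {t} 0≤t with locate 0≤t
    ... | inj₁ (i , i<m , τ≤t , t<τ) = subst (_≤ 1ℚ) (sum-cong-≗ λ j → sym (rateAt-segments j i<m τ≤t t<τ)) (∑R≤1 i i<m)
    ... | inj₂ τ≤t = subst (_≤ 1ℚ) (sym (trans (sum-cong-≗ λ j → rateAt-after j τ≤t) (sum-replicate-zero n))) (nonNegative⁻¹ 1ℚ)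

module _ (I : Instance) (p : ℕ → ℚ) (0<p : ∀ k → 0ℚ < p k) where
  open Instance I

  module _ (size≡p : ∀ j → size j ≡ p (toℕ j)) (release≤start : ∀ j → release j ≤ prefix p (toℕ j)) where

    private
      start = prefix p

      start-< : ∀ k → start k < start (suc k)
      start-< k = <-by-gap (p k) (0<p k) refl

      R : ℕ → Fin jobs → ℚ
      R k j = 𝟙 (toℕ j ℕP.≟ k)

      open Segments start (λ k → <⇒≤ (start-< k)) R

      πs : List (Piece jobs)
      πs = segments 0 jobs

      ds : All (λ π → 0ℚ ≤ duration π) πs
      ds = segments-duration≥0 0 jobs

      rate-≥0 : ∀ j t → 0ℚ ≤ t → 0ℚ ≤ rateAt πs j t
      rate-≥0 j t 0≤t = rateAt-cases refl jobs (0ℚ ≤_) j 0≤t (λ i _ _ _ → 0≤𝟙 (toℕ j ℕP.≟ i)) ≤-refl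

      rate-≤1 : ∀ j t → 0ℚ ≤ t → rateAt πs j t ≤ 1ℚ
      rate-≤1 j t 0≤t = rateAt-cases refl jobs (_≤ 1ℚ) j 0≤t (λ i _ _ _ → 𝟙≤1 (toℕ j ℕP.≟ i)) (nonNegative⁻¹ 1ℚ)

      rate-before : ∀ j t → 0ℚ ≤ t → t < start (toℕ j) → rateAt πs j t ≡ 0ℚ
      rate-before j t 0≤t t<start = rateAt-cases refl jobs (_≡ 0ℚ) j 0≤t
        (λ i _ start≤t _ → 𝟙-false (toℕ j ℕP.≟ i) (λ { refl → ≤⇒≯ start≤t t<start })) refl

      ∑R≤1 : ∀ i → i ℕ.< jobs → ∑ (R i) ≤ 1ℚ
      ∑R≤1 i i<n = ≤-reflexive (trans (sum-cong-≗ λ j → sym (*-identityʳ (R i j))) (∑-𝟙-≟ {jobs} (λ _ → 1ℚ) i i<n))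

      module _ (j : Fin jobs) where
        begins = start (toℕ j)
        ends   = start (suc (toℕ j))

        0≤begins : 0ℚ ≤ begins
        0≤begins = τ-mono-≤ {0} {toℕ j} ℕ.z≤n

        -- Nonnegative rates suffice up to `begins`; from there to `ends` the job has the whole
        -- machine.
        work : size j ≤ integral πs j (release j) ends
        work = begin
          size j                                                            ≡⟨ size≡p j ⟩
          p (toℕ j)                                                         ≡⟨ solve 3 (λ p b r → p := con 0ℚ :* (b :- r) :+ con 1ℚ :* (b :+ p :- b)) refl (p (toℕ j)) begins (release j) ⟩
          0ℚ * (begins - release j) + 1ℚ * (ends - begins)                  ≤⟨ +-mono-≤
            (integral-≥ (evaluation j) 0ℚ ds (release≥0 j) (release≤start j) (λ t r≤t _ → rate-≥0 j t (≤-trans (release≥0 j) r≤t)))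
            (integral-≥ (evaluation j) 1ℚ ds 0≤begins (<⇒≤ (start-< (toℕ j))) (λ t b≤t t<e → ≤-reflexive (sym
              (trans (rateAt-segments refl jobs j (FinP.toℕ<n j) b≤t t<e) (𝟙-true (toℕ j ℕP.≟ toℕ j) refl))))) ⟩
          integral πs j (release j) begins + integral πs j begins ends      ≡⟨ integral-split πs j (release j) begins ends ⟨
          integral πs j (release j) ends                                    ∎
          where open ≤-Reasoning

        idle-before : ∀ {t} → release j ≤ t → t ≤ begins → integral πs j (release j) t ≤ 0ℚ
        idle-before {t} r≤t t≤b = subst (integral πs j (release j) t ≤_) (*-zeroˡ (t - release j))
          (integral-≤ (evaluation j) 0ℚ ds (release≥0 j) r≤t
            (λ u r≤u u<t → ≤-reflexive (rate-before j u (≤-trans (release≥0 j) r≤u) (<-≤-trans u<t t≤b))))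

        -- Nothing is processed before `begins`, and at most `t - begins` from then until `t`, which
        -- is less than the size.
        unfinished : ∀ {t} → release j ≤ t → t < ends → integral πs j (release j) t < size j
        unfinished {t} r≤t t<e with ≤-total t begins
        ... | inj₁ t≤b = ≤-<-trans (idle-before r≤t t≤b) (size>0 j)
        ... | inj₂ b≤t = begin-strict
          integral πs j (release j) t                                 ≡⟨ integral-split πs j (release j) begins t ⟩
          integral πs j (release j) begins + integral πs j begins t   ≤⟨ +-mono-≤ (idle-before (release≤start j) ≤-refl)
            (integral-≤ (evaluation j) 1ℚ ds 0≤begins b≤t (λ u b≤u _ → rate-≤1 j u (≤-trans 0≤begins b≤u))) ⟩
          0ℚ + 1ℚ * (t - begins)                                      ≡⟨ solve 2 (λ t b → con 0ℚ :+ con 1ℚ :* (t :- b) := t :- b) refl t begins ⟩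
          t - begins                                                  <⟨ +-monoˡ-< (- begins) t<e ⟩
          ends - begins                                               ≡⟨ solve 2 (λ p b → b :+ p :- b := p) refl (p (toℕ j)) begins ⟩
          p (toℕ j)                                                   ≡⟨ size≡p j ⟨
          size j                                                      ∎
          where open ≤-Reasoning

    sequential : Schedule I
    sequential = record
      { pieces           = πs
      ; duration≥0       = ds
      ; rate≥0           = rate-≥0
      ; capacity         = λ t → ∑-rateAt-≤1 refl jobs ∑R≤1
      ; before-release   = λ j t 0≤t t<r → rate-before j t 0≤t (<-≤-trans t<r (release≤start j))
      ; completion       = λ j → prefix p (suc (toℕ j))
      ; release≤complete = λ j → ≤-trans (release≤start j) (<⇒≤ (start-< (toℕ j)))
      ; processed        = work
      ; first            = λ j t r≤t work≤ → ≮⇒≥ λ t<e → ≤⇒≯ work≤ (unfinished j r≤t t<e)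
      }

-- Round-Robin schedules in which all jobs finish together

∑-𝟙-count : ∀ {n} {P : Fin n → Set} (P? : ∀ j → Dec (P j)) → ∑ (λ j → 𝟙 (P? j)) ≡ fromℕ ∣ tabulate (λ j → does (P? j)) ∣
∑-𝟙-count {zero}  P? = refl
∑-𝟙-count {suc n} P? with does (P? zero)
... | true  = trans (cong (_+_ 1ℚ) (∑-𝟙-count (λ j → P? (suc j)))) (sym (fromℕ-suc ∣ tabulate (λ j → does (P? (suc j))) ∣))
... | false = trans (+-identityˡ _) (∑-𝟙-count (λ j → P? (suc j)))

fromℕ*reciprocal≤1 : ∀ k → fromℕ k * reciprocal k ≤ 1ℚ
fromℕ*reciprocal≤1 zero    = nonNegative⁻¹ 1ℚ
fromℕ*reciprocal≤1 (suc k) = ≤-reflexive (fromℕ*reciprocal k)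

0≤reciprocal : ∀ k → 0ℚ ≤ reciprocal k
0≤reciprocal zero    = ≤-refl
0≤reciprocal (suc k) = nonNegative⁻¹ (reciprocal (suc k)) {{normalize-nonNeg 1 (suc k)}}

0<reciprocal : ∀ k → 0ℚ < reciprocal (suc k)
0<reciprocal k = positive⁻¹ (reciprocal (suc k)) {{normalize-pos 1 (suc k)}}

module _ (I : Instance) where
  open Instance I

  module _ (level : Fin jobs → ℕ) where

    arrived : ℕ → Subset jobs
    arrived i = tabulate λ j → does (level j ℕP.≤? i)

    -- `rest i` is the work that every arrived job still lacks at `τ i`. By `size≡rest` a new job
    -- starts level with the old ones, `rest-step` takes away one equal share per interval, and
    -- `rest-end` makes all jobs finish at `τ (suc top)`.
    module _ (top : ℕ) (level≤top : ∀ j → level j ℕ.≤ top)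
             (τ : ℕ → ℚ) (τ₀ : τ 0 ≡ 0ℚ) (τ-mono : ∀ i → τ i ≤ τ (suc i)) (τ-top : τ top < τ (suc top))
             (release≡τ : ∀ j → release j ≡ τ (level j))
             (rest : ℕ → ℚ) (rest-end : rest (suc top) ≡ 0ℚ)
             (rest-step : ∀ i → i ℕ.≤ top → rest i ≡ rest (suc i) + reciprocal ∣ arrived i ∣ * (τ (suc i) - τ i))
             (size≡rest : ∀ j → size j ≡ rest (level j))
             (0<share : 0ℚ < reciprocal ∣ arrived top ∣)
             where

      private
        R : ℕ → Fin jobs → ℚ
        R i j = 𝟙 (level j ℕP.≤? i) * reciprocal ∣ arrived i ∣

        open Segments τ τ-mono R

        end : ℚ
        end = τ (suc top)

        πs : List (Piece jobs)
        πs = segments 0 (suc top)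

        ds : All (λ π → 0ℚ ≤ duration π) πs
        ds = segments-duration≥0 0 (suc top)

        0≤τ : ∀ i → 0ℚ ≤ τ i
        0≤τ i = subst (_≤ τ i) τ₀ (τ-mono-≤ ℕ.z≤n)

        rate-≥0 : ∀ j t → 0ℚ ≤ t → 0ℚ ≤ rateAt πs j t
        rate-≥0 j t 0≤t = rateAt-cases τ₀ (suc top) (0ℚ ≤_) j 0≤t
          (λ i _ _ _ → 0≤p*q (0≤𝟙 (level j ℕP.≤? i)) (0≤reciprocal ∣ arrived i ∣)) ≤-refl

        ∑R≤1 : ∀ i → i ℕ.< suc top → ∑ (R i) ≤ 1ℚ
        ∑R≤1 i _ = subst (_≤ 1ℚ)
          (trans (cong (_* reciprocal ∣ arrived i ∣) (sym (∑-𝟙-count (λ j → level j ℕP.≤? i))))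
                 (*-distribʳ-sum (reciprocal ∣ arrived i ∣) (λ j → 𝟙 (level j ℕP.≤? i))))
          (fromℕ*reciprocal≤1 ∣ arrived i ∣)

        released : ∀ j {i t} → level j ℕ.≤ i → τ i ≤ t → release j ≤ t
        released j {t = t} ℓ≤i τ≤t = ≤-trans (subst (_≤ τ _) (sym (release≡τ j)) (τ-mono-≤ ℓ≤i)) τ≤t

        rate-before : ∀ j t → 0ℚ ≤ t → t < release j → rateAt πs j t ≡ 0ℚ
        rate-before j t 0≤t t<r = rateAt-cases τ₀ (suc top) (_≡ 0ℚ) j 0≤t
          (λ i _ τ≤t _ → trans (cong (_* reciprocal ∣ arrived i ∣)
                                     (𝟙-false (level j ℕP.≤? i) λ ℓ≤i → ≤⇒≯ (released j ℓ≤i τ≤t) t<r))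
                               (*-zeroˡ (reciprocal ∣ arrived i ∣)))
          refl

        rate-during : ∀ j i {t} → level j ℕ.≤ i → i ℕ.≤ top → τ i ≤ t → t < τ (suc i) → rateAt πs j t ≡ reciprocal ∣ arrived i ∣
        rate-during j i {t} ℓ≤i i≤top τ≤t t<τ = begin
          rateAt πs j t                                         ≡⟨ rateAt-segments τ₀ (suc top) j (ℕ.s≤s i≤top) τ≤t t<τ ⟩
          𝟙 (level j ℕP.≤? i) * reciprocal ∣ arrived i ∣        ≡⟨ cong (_* reciprocal ∣ arrived i ∣) (𝟙-true (level j ℕP.≤? i) ℓ≤i) ⟩
          1ℚ * reciprocal ∣ arrived i ∣                         ≡⟨ *-identityˡ (reciprocal ∣ arrived i ∣) ⟩
          reciprocal ∣ arrived i ∣                              ∎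
          where open ≡-Reasoning

        integral-during : ∀ j i → level j ℕ.≤ i → i ℕ.≤ top → ∀ {a b} → τ i ≤ a → a ≤ b → b ≤ τ (suc i) →
                          integral πs j a b ≡ reciprocal ∣ arrived i ∣ * (b - a)
        integral-during j i ℓ≤i i≤top τ≤a a≤b b≤τ = ≤-antisym
          (integral-≤ (evaluation j) (reciprocal ∣ arrived i ∣) ds 0≤a a≤b (λ t a≤t t<b → ≤-reflexive (rate≡ t a≤t t<b)))
          (integral-≥ (evaluation j) (reciprocal ∣ arrived i ∣) ds 0≤a a≤b (λ t a≤t t<b → ≤-reflexive (sym (rate≡ t a≤t t<b))))
          where
          0≤a = ≤-trans (0≤τ i) τ≤a
          rate≡ : ∀ t → _ → _ → _
          rate≡ t a≤t t<b = rate-during j i ℓ≤i i≤top (≤-trans τ≤a a≤t) (<-≤-trans t<b b≤τ)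

        -- Adds up `rest-step` over the `d` intervals following the release of `j`.
        integral-rest : ∀ j d → level j ℕ.+ d ℕ.≤ suc top →
                        rest (level j) ≡ rest (level j ℕ.+ d) + integral πs j (τ (level j)) (τ (level j ℕ.+ d))
        integral-rest j zero _ rewrite ℕP.+-identityʳ (level j) =
          solve 2 (λ r c → r := r :+ (c :- c)) refl (rest (level j)) (cumulative πs j (τ (level j)))
        integral-rest j (suc d) ≤top rewrite ℕP.+-suc (level j) d = begin
          rest ℓ                                                                  ≡⟨ integral-rest j d (ℕP.<⇒≤ ≤top) ⟩
          rest i + integral πs j (τ ℓ) (τ i)                                      ≡⟨ cong (_+ integral πs j (τ ℓ) (τ i)) (rest-step i i≤top) ⟩
          rest (suc i) + share + integral πs j (τ ℓ) (τ i)                        ≡⟨ cong (λ z → rest (suc i) + z + integral πs j (τ ℓ) (τ i))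
            (integral-during j i (ℕP.m≤m+n ℓ d) i≤top ≤-refl (τ-mono i) ≤-refl) ⟨
          rest (suc i) + integral πs j (τ i) (τ (suc i)) + integral πs j (τ ℓ) (τ i)
            ≡⟨ solve 4 (λ r x y z → r :+ (z :- y) :+ (y :- x) := r :+ (z :- x)) refl (rest (suc i))
                 (cumulative πs j (τ ℓ)) (cumulative πs j (τ i)) (cumulative πs j (τ (suc i))) ⟩
          rest (suc i) + integral πs j (τ ℓ) (τ (suc i))                          ∎
          where
          open ≡-Reasoning
          ℓ = level j
          i = ℓ ℕ.+ d
          i≤top = ℕP.≤-pred ≤top
          share = reciprocal ∣ arrived i ∣ * (τ (suc i) - τ i)

        release≤end : ∀ j → release j ≤ end
        release≤end j = subst (_≤ end) (sym (release≡τ j)) (τ-mono-≤ (ℕP.m≤n⇒m≤1+n (level≤top j)))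

        size≡integral : ∀ j → size j ≡ integral πs j (release j) end
        size≡integral j = begin
          size j                                                        ≡⟨ size≡rest j ⟩
          rest (level j)                                                ≡⟨ integral-rest j d (ℕP.≤-reflexive ℓ+d≡) ⟩
          rest (level j ℕ.+ d) + integral πs j (τ (level j)) (τ (level j ℕ.+ d))  ≡⟨ cong (λ k → rest k + integral πs j (τ (level j)) (τ k)) ℓ+d≡ ⟩
          rest (suc top) + integral πs j (τ (level j)) end              ≡⟨ cong₂ (λ z r → z + integral πs j r end) rest-end (sym (release≡τ j)) ⟩
          0ℚ + integral πs j (release j) end                            ≡⟨ +-identityˡ _ ⟩
          integral πs j (release j) end                                 ∎
          where
          open ≡-Reasoning
          d = suc top ℕ.∸ level j
          ℓ+d≡ : level j ℕ.+ d ≡ suc top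
          ℓ+d≡ = ℕP.m+[n∸m]≡n (ℕP.m≤n⇒m≤1+n (level≤top j))

        -- The work still to come after `t` is positive: any `t < end` leaves a part of the final
        -- interval, which has positive length and gives every job a positive share.
        unfinished : ∀ j {t} → release j ≤ t → t < end → integral πs j (release j) t < size j
        unfinished j {t} r≤t t<end = <-by-gap (integral πs j t end) remaining
          (trans (size≡integral j) (integral-split πs j (release j) t end))
          where
          0≤t = ≤-trans (release≥0 j) r≤t

          0<integral-top : ∀ {a} → τ top ≤ a → a < end → 0ℚ < integral πs j a end
          0<integral-top τ≤a a<end = subst (0ℚ <_)
            (sym (integral-during j top (level≤top j) ℕP.≤-refl τ≤a (<⇒≤ a<end) ≤-refl))
            (0<p*q 0<share (p<q⇒0<q-p a<end))

          remaining : 0ℚ < integral πs j t end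
          remaining with ≤-total (τ top) t
          ... | inj₁ τ≤t = 0<integral-top τ≤t t<end
          ... | inj₂ t≤τ = subst (0ℚ <_) (sym (integral-split πs j t (τ top) end))
            (+-mono-≤-< (subst (_≤ integral πs j t (τ top)) (*-zeroˡ (τ top - t))
                          (integral-≥ (evaluation j) 0ℚ ds 0≤t t≤τ (λ u t≤u _ → rate-≥0 j u (≤-trans 0≤t t≤u))))
                        (0<integral-top ≤-refl τ-top))

      roundRobin : Schedule I
      roundRobin = record
        { pieces           = πs
        ; duration≥0       = ds
        ; rate≥0           = rate-≥0
        ; capacity         = λ t → ∑-rateAt-≤1 τ₀ (suc top) ∑R≤1
        ; before-release   = rate-before
        ; completion       = λ _ → end
        ; release≤complete = release≤end
        ; processed        = λ j → ≤-reflexive (size≡integral j)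
        ; first            = λ j t r≤t work≤ → ≮⇒≥ λ t<end → ≤⇒≯ work≤ (unfinished j r≤t t<end)
        }

      private
        ∈⇒does : ∀ {f : Fin jobs → Bool} {j} → j ∈ tabulate f → f j ≡ true
        ∈⇒does {f} {j} j∈ = trans (sym (lookup∘tabulate f j)) ([]=⇒lookup j∈)

        ∉⇒does : ∀ {f : Fin jobs → Bool} {j} → j ∉ tabulate f → f j ≡ false
        ∉⇒does {f} {j} j∉ = ¬-not λ fj → j∉ (lookup⇒[]= j (tabulate f) (trans (lookup∘tabulate f j) fj))

        -- All jobs complete at `end`, so before that time being available means having been
        -- released, and releases happen only at the breakpoints `τ`.
        available≡arrived : ∀ i {t} → τ i ≤ t → t < τ (suc i) → i ℕ.≤ top → Schedule.available roundRobin t ≡ arrived i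
        available≡arrived i {t} τ≤t t<τ i≤top = tabulate-cong λ j → same j (level j ℕP.≤? i)
          where
          same : ∀ j → Dec (level j ℕ.≤ i) → (does (release j ≤? t) ∧ does (t <? end)) ≡ does (level j ℕP.≤? i)
          same j (yes ℓ≤i) = trans
            (cong₂ _∧_ (dec-true (release j ≤? t) (released j ℓ≤i τ≤t))
                       (dec-true (t <? end) (<-≤-trans t<τ (τ-mono-≤ (ℕ.s≤s i≤top)))))
            (sym (dec-true (level j ℕP.≤? i) ℓ≤i))
          same j (no ℓ≰i) = trans
            (cong (_∧ does (t <? end)) (dec-false (release j ≤? t) λ r≤t →
              ≤⇒≯ r≤t (<-≤-trans t<τ (subst (τ (suc i) ≤_) (sym (release≡τ j)) (τ-mono-≤ (ℕP.≰⇒> ℓ≰i))))))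
            (sym (dec-false (level j ℕP.≤? i) ℓ≰i))

      roundRobin-isRoundRobin : IsRoundRobin roundRobin
      roundRobin-isRoundRobin j t 0≤t with locate τ₀ (suc top) 0≤t
      ... | inj₁ (i , ℕ.s≤s i≤top , τ≤t , t<τ) rewrite available≡arrived i τ≤t t<τ i≤top = on , off
        where
        on : j ∈ arrived i → rateAt πs j t ≡ reciprocal ∣ arrived i ∣
        on j∈ = trans (rateAt-segments τ₀ (suc top) j (ℕ.s≤s i≤top) τ≤t t<τ)
          (trans (cong (λ b → (if b then 1ℚ else 0ℚ) * reciprocal ∣ arrived i ∣) (∈⇒does j∈)) (*-identityˡ (reciprocal ∣ arrived i ∣)))
        off : j ∉ arrived i → rateAt πs j t ≡ 0ℚ
        off j∉ = trans (rateAt-segments τ₀ (suc top) j (ℕ.s≤s i≤top) τ≤t t<τ)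
          (trans (cong (λ b → (if b then 1ℚ else 0ℚ) * reciprocal ∣ arrived i ∣) (∉⇒does j∉)) (*-zeroˡ (reciprocal ∣ arrived i ∣)))
      ... | inj₂ end≤t = on , (λ _ → rateAt-after τ₀ (suc top) j end≤t)
        where
        on : j ∈ Schedule.available roundRobin t → _
        -- No job is available once the common completion time is reached, so membership is absurd.
        on j∈ with trans (sym (∈⇒does j∈)) (cong₂ _∧_ refl (dec-false (t <? end) (≤⇒≯ end≤t)))
        ... | eq = contradiction (trans eq (∧-zeroʳ (does (release j ≤? t)))) λ ()

-- The instance

module LowerBoundInstance (K e : ℕ) where

  ρ : ℕ
  ρ = suc e

  -- Once batch `i` has arrived there are `ρ + 1` jobs of batch 0 and two of each batch from 1 to
  -- `i`; one of them is not counted.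
  others : ℕ → ℕ
  others i = ρ ℕ.+ (i ℕ.+ i)

  c : ℕ → ℚ
  c i = fromℕ (others i)

  -- While the optimum runs one job of batch i, Round-Robin gives the share s i / (1 + others i)
  -- to each of the 1 + others i available jobs.
  s : ℕ → ℚ
  s zero    = 1ℚ
  s (suc i) = s i * (c i * reciprocal (suc (others i)))

  0<s : ∀ i → 0ℚ < s i
  0<s zero    = positive⁻¹ 1ℚ
  0<s (suc i) = 0<p*q (0<s i) (0<p*q (0<fromℕ (e ℕ.+ (i ℕ.+ i))) (0<reciprocal (others i)))

  -- The reciprocal of `s`, by its own recursion.
  v : ℕ → ℚ
  v zero    = 1ℚ
  v (suc i) = v i * (fromℕ (suc (others i)) * reciprocal (others i))

  v*s : ∀ i → v i * s i ≡ 1ℚ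
  v*s zero    = refl
  v*s (suc i) = begin
    v i * (N * r) * (s i * (c i * q))    ≡⟨ solve 6 (λ v n r s c q → v :* (n :* r) :* (s :* (c :* q)) := (v :* s) :* ((c :* r) :* (n :* q))) refl (v i) N r (s i) (c i) q ⟩
    (v i * s i) * ((c i * r) * (N * q))  ≡⟨ cong₂ (λ x y → x * y) (v*s i) (cong₂ _*_ (fromℕ*reciprocal (e ℕ.+ (i ℕ.+ i))) (fromℕ*reciprocal (others i))) ⟩
    1ℚ                                   ∎
    where
    open ≡-Reasoning
    N = fromℕ (suc (others i))
    r = reciprocal (others i)
    q = reciprocal (suc (others i))

  0≤v : ∀ i → 0ℚ ≤ v i
  0≤v zero    = nonNegative⁻¹ 1ℚ
  0≤v (suc i) = 0≤p*q (0≤v i) (0≤p*q (0≤fromℕ (suc (others i))) (0≤reciprocal (others i)))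

  v-mono : ∀ i → v i ≤ v (suc i)
  v-mono i = ≤-by-gap (v i * r) (0≤p*q (0≤v i) (0≤reciprocal (others i))) (begin
    v i * (fromℕ (suc (others i)) * r)  ≡⟨ cong (λ n → v i * (n * r)) (fromℕ-suc (others i)) ⟩
    v i * ((1ℚ + c i) * r)              ≡⟨ solve 3 (λ v c r → v :* ((con 1ℚ :+ c) :* r) := v :* (c :* r) :+ v :* r) refl (v i) (c i) r ⟩
    v i * (c i * r) + v i * r           ≡⟨ cong (λ z → v i * z + v i * r) (fromℕ*reciprocal (e ℕ.+ (i ℕ.+ i))) ⟩
    v i * 1ℚ + v i * r                  ≡⟨ cong (_+ v i * r) (*-identityʳ (v i)) ⟩
    v i + v i * r                       ∎)
    where
    open ≡-Reasoning
    r = reciprocal (others i)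

  c-suc : ∀ i → c (suc i) ≡ c i + fromℕ 2
  c-suc i = trans (cong fromℕ (solveℕ 2 (λ r i → r :+ℕ ((conℕ 1 :+ℕ i) :+ℕ (conℕ 1 :+ℕ i)) :=ℕ r :+ℕ (i :+ℕ i) :+ℕ conℕ 2) refl ρ i))
    (fromℕ-+ (others i) 2)

  s-suc : ∀ i → (c i + 1ℚ) * s (suc i) ≡ c i * s i
  s-suc i = begin
    (c i + 1ℚ) * (s i * (c i * q))   ≡⟨ solve 3 (λ c s q → (c :+ con 1ℚ) :* (s :* (c :* q)) := c :* s :* ((con 1ℚ :+ c) :* q)) refl (c i) (s i) q ⟩
    c i * s i * ((1ℚ + c i) * q)     ≡⟨ cong (λ n → c i * s i * (n * q)) (fromℕ-suc (others i)) ⟨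
    c i * s i * (fromℕ (suc (others i)) * q)  ≡⟨ cong (_*_ (c i * s i)) (fromℕ*reciprocal (others i)) ⟩
    c i * s i * 1ℚ                   ≡⟨ *-identityʳ (c i * s i) ⟩
    c i * s i                        ∎
    where
    open ≡-Reasoning
    q = reciprocal (suc (others i))

  s-drop : ∀ i → s i ≡ s (suc i) + reciprocal (suc (others i)) * s i
  s-drop i = begin
    s i                                       ≡⟨ *-identityʳ (s i) ⟨
    s i * 1ℚ                                  ≡⟨ cong (_*_ (s i)) (fromℕ*reciprocal (others i)) ⟨
    s i * (fromℕ (suc (others i)) * q)        ≡⟨ cong (λ n → s i * (n * q)) (fromℕ-suc (others i)) ⟩
    s i * ((1ℚ + c i) * q)                    ≡⟨ solve 3 (λ s c q → s :* ((con 1ℚ :+ c) :* q) := s :* (c :* q) :+ q :* s) refl (s i) (c i) q ⟩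
    s (suc i) + q * s i                       ∎
    where
    open ≡-Reasoning
    q = reciprocal (suc (others i))

  -- The quantity `s i * s i * c i` never increases: with `a = s i` and `b = s (suc i)`, `s-suc` and
  -- `c-suc` give a drop of exactly `b * (a - b)`. This bounds `s` by a square root without
  -- mentioning one.
  s²c≤c₀ : ∀ i → s i * s i * c i ≤ c 0
  s²c≤c₀ zero = ≤-reflexive (solve 1 (λ c → con 1ℚ :* con 1ℚ :* c := c) refl (c 0))
  s²c≤c₀ (suc i) = ≤-trans (≤-by-gap (b * (a - b)) (0≤p*q (<⇒≤ (0<s (suc i))) 0≤a-b) (begin
    a * a * c i                                       ≡⟨ solve 2 (λ a c → a :* a :* c := a :* (c :* a)) refl a (c i) ⟩
    a * (c i * a)                                     ≡⟨ cong (_*_ a) (s-suc i) ⟨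
    a * ((c i + 1ℚ) * b)                              ≡⟨ solve 3 (λ a c b → a :* ((c :+ con 1ℚ) :* b) := b :* (c :* a) :+ a :* b) refl a (c i) b ⟩
    b * (c i * a) + a * b                             ≡⟨ cong (λ z → b * z + a * b) (s-suc i) ⟨
    b * ((c i + 1ℚ) * b) + a * b                      ≡⟨ solve 3 (λ a c b → b :* ((c :+ con 1ℚ) :* b) :+ a :* b := b :* b :* (c :+ con (fromℕ 2)) :+ b :* (a :- b)) refl a (c i) b ⟩
    b * b * (c i + fromℕ 2) + b * (a - b)             ≡⟨ cong (λ z → b * b * z + b * (a - b)) (c-suc i) ⟨
    b * b * c (suc i) + b * (a - b)                   ∎))
    (s²c≤c₀ i)
    where
    open ≡-Reasoning
    a = s i
    b = s (suc i)
    0≤a-b : 0ℚ ≤ a - b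
    0≤a-b = p≤q⇒0≤q-p (≤-by-gap (reciprocal (suc (others i)) * a) (0≤p*q (0≤reciprocal (suc (others i))) (<⇒≤ (0<s i))) (s-drop i))

  -- Processing order of the optimum and its completion times

  last : ℕ
  last = suc (K ℕ.+ K)

  -- One job of each batch from 0 up to `K`, one of each from `K` down to 1, and then the remaining
  -- `ρ` jobs of batch 0, the first of which has index `last`.
  n : ℕ
  n = last ℕ.+ ρ

  -- Jobs are numbered in the order in which the optimum processes them, and job k belongs to
  -- batch level k.  The last jobs are of batch 0, by truncated subtraction.
  level : ℕ → ℕ
  level k = k ℕ.⊓ (last ℕ.∸ k)

  level≤k : ∀ k → level k ℕ.≤ k
  level≤k k = ℕP.m⊓n≤m k (last ℕ.∸ k)

  ≤level : ∀ {i k} → i ℕ.≤ k → i ℕ.+ k ℕ.≤ last → i ℕ.≤ level k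
  ≤level {i} i≤k i+k≤last = ℕP.⊓-glb i≤k (ℕP.m+n≤o⇒m≤o∸n i i+k≤last)

  level≤ : ∀ {i} k → last ℕ.≤ k ℕ.+ i → level k ℕ.≤ i
  level≤ k last≤k+i = ℕP.≤-trans (ℕP.m⊓n≤n k (last ℕ.∸ k)) (ℕP.m≤n+o⇒m∸n≤o last k last≤k+i)

  level-ascending : ∀ {i} → i ℕ.≤ K → level i ≡ i
  level-ascending i≤K = ℕP.≤-antisym (level≤k _) (≤level ℕP.≤-refl (ℕP.m≤n⇒m≤1+n (ℕP.+-mono-≤ i≤K i≤K)))

  level≤K : ∀ k → level k ℕ.≤ K
  level≤K k with ℕP.≤-total k K
  ... | inj₁ k≤K = ℕP.≤-trans (level≤k k) k≤K
  ... | inj₂ K≤k with ℕP.m≤n⇒m<n∨m≡n K≤k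
  ...   | inj₁ K<k  = level≤ k (ℕP.+-monoˡ-≤ K K<k)
  ...   | inj₂ refl = level≤k K

  level-descending : ∀ i d → i ℕ.+ d ≡ K → level (suc K ℕ.+ d) ≡ i
  level-descending i d refl = ℕP.≤-antisym
    (level≤ (suc K ℕ.+ d) (ℕP.≤-reflexive (solveℕ 2 (λ i d → conℕ 1 :+ℕ (i :+ℕ d :+ℕ (i :+ℕ d)) :=ℕ conℕ 1 :+ℕ (i :+ℕ d) :+ℕ d :+ℕ i) refl i d)))
    (≤level (ℕP.≤-trans (ℕP.m≤m+n i d) (ℕP.≤-trans (ℕP.n≤1+n K) (ℕP.m≤m+n (suc K) d)))
      (ℕP.≤-reflexive (solveℕ 2 (λ i d → i :+ℕ (conℕ 1 :+ℕ (i :+ℕ d) :+ℕ d) :=ℕ conℕ 1 :+ℕ (i :+ℕ d :+ℕ (i :+ℕ d))) refl i d)))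

  level-0 : ∀ k → last ℕ.≤ k → level k ≡ 0
  level-0 k last≤k = ℕP.n≤0⇒n≡0 (level≤ k (subst (last ℕ.≤_) (sym (ℕP.+-identityʳ k)) last≤k))

  p : ℕ → ℚ
  p k = s (level k)

  0<p : ∀ k → 0ℚ < p k
  0<p k = 0<s (level k)

  P : ℕ → ℚ
  P = prefix p

  P-mono : ∀ {i k} → i ℕ.≤ k → P i ≤ P k
  P-mono = prefix-mono p (λ k → <⇒≤ (0<p k))

  -- The sum telescopes: by `s-suc` and `c (suc i) - 1ℚ = c i + 1ℚ`, the product `(c i - 1ℚ) * s i`
  -- grows by exactly `s i`.
  P-ascending : ∀ i → i ℕ.≤ suc K → P i ≡ (c i - 1ℚ) * s i - (c 0 - 1ℚ)
  P-ascending zero    _ = solve 1 (λ c → con 0ℚ := (c :- con 1ℚ) :* con 1ℚ :- (c :- con 1ℚ)) refl (c 0)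
  P-ascending (suc i) (ℕ.s≤s i≤K) = begin
    P i + p i                                             ≡⟨ cong₂ _+_ (P-ascending i (ℕP.m≤n⇒m≤1+n i≤K)) (cong s (level-ascending i≤K)) ⟩
    (c i - 1ℚ) * s i - (c 0 - 1ℚ) + s i                   ≡⟨ solve 3 (λ c s z → (c :- con 1ℚ) :* s :- (z :- con 1ℚ) :+ s := c :* s :- (z :- con 1ℚ)) refl (c i) (s i) (c 0) ⟩
    c i * s i - (c 0 - 1ℚ)                                ≡⟨ cong (λ x → x - (c 0 - 1ℚ)) (s-suc i) ⟨
    (c i + 1ℚ) * s (suc i) - (c 0 - 1ℚ)                   ≡⟨ solve 3 (λ c s z → (c :+ con 1ℚ) :* s :- (z :- con 1ℚ) := (c :+ con (fromℕ 2) :- con 1ℚ) :* s :- (z :- con 1ℚ)) refl (c i) (s (suc i)) (c 0) ⟩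
    (c i + fromℕ 2 - 1ℚ) * s (suc i) - (c 0 - 1ℚ)         ≡⟨ cong (λ x → (x - 1ℚ) * s (suc i) - (c 0 - 1ℚ)) (c-suc i) ⟨
    (c (suc i) - 1ℚ) * s (suc i) - (c 0 - 1ℚ)             ∎
    where open ≡-Reasoning

  -- The time at which the optimum has finished one job of every batch and turns back.
  mid : ℚ
  mid = P (suc K)

  -- Jobs `suc K + d` and `K - d` belong to the same batch, so start times are symmetric about
  -- `mid`.
  P-mirror : ∀ d i → i ℕ.+ d ≡ suc K → P (suc K ℕ.+ d) + P i ≡ mid + mid
  P-mirror zero i i≡ rewrite ℕP.+-identityʳ i | i≡ | ℕP.+-identityʳ K = refl
  P-mirror (suc d) i i+d≡ rewrite ℕP.+-suc K d = begin
    P (suc K ℕ.+ d) + p (suc K ℕ.+ d) + P i   ≡⟨ cong (λ l → P (suc K ℕ.+ d) + s l + P i) (trans (level-descending i d i+d≡K) (sym (level-ascending i≤K))) ⟩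
    P (suc K ℕ.+ d) + p i + P i               ≡⟨ solve 3 (λ x y z → x :+ y :+ z := x :+ (z :+ y)) refl (P (suc K ℕ.+ d)) (p i) (P i) ⟩
    P (suc K ℕ.+ d) + P (suc i)               ≡⟨ P-mirror d (suc i) (cong suc i+d≡K) ⟩
    mid + mid                                 ∎
    where
    open ≡-Reasoning
    i+d≡K : i ℕ.+ d ≡ K
    i+d≡K = ℕP.suc-injective (trans (sym (ℕP.+-suc i d)) i+d≡)
    i≤K : i ℕ.≤ K
    i≤K = subst (i ℕ.≤_) i+d≡K (ℕP.m≤m+n i d)

  -- Two jobs of each batch take `mid + mid`; the further jobs all have size 1.
  P-tail : ∀ f → P (suc last ℕ.+ f) ≡ mid + mid + fromℕ f
  P-tail f = begin
    P (suc last ℕ.+ f)               ≡⟨ prefix-const p (suc last) f 1ℚ (λ d _ → cong s (level-0 (suc last ℕ.+ d) (ℕP.≤-trans (ℕP.n≤1+n last) (ℕP.m≤m+n (suc last) d)))) ⟩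
    P (suc last) + fromℕ f * 1ℚ      ≡⟨ cong₂ _+_ (trans (cong P (sym (ℕP.+-suc (suc K) K))) (trans (sym (+-identityʳ (P (suc K ℕ.+ suc K)))) (P-mirror (suc K) 0 refl))) (*-identityʳ (fromℕ f)) ⟩
    mid + mid + fromℕ f              ∎
    where open ≡-Reasoning

  -- Total completion time of the first jobs in the optimum.
  U : ℕ → ℚ
  U = prefix (λ k → P (suc k))

  -- Job `K` completes at `mid`. The other jobs from `i` to `K + d` pair up, each pair having
  -- completion times that sum to `mid + mid`.
  U-mirror : ∀ d i → i ℕ.+ d ≡ K → U (suc K ℕ.+ d) ≡ U i + fromℕ (suc (d ℕ.+ d)) * mid
  U-mirror zero i i≡ rewrite ℕP.+-identityʳ i | i≡ | ℕP.+-identityʳ K =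
    solve 2 (λ u m → u :+ m := u :+ con 1ℚ :* m) refl (U K) mid
  U-mirror (suc d) i i+d≡ rewrite ℕP.+-suc K d | ℕP.+-suc d d = begin
    U (suc K ℕ.+ d) + P (suc (suc K ℕ.+ d))                       ≡⟨ cong (_+ P (suc (suc K ℕ.+ d))) (U-mirror d (suc i) i+d≡K) ⟩
    U i + P (suc i) + m * mid + P (suc (suc K ℕ.+ d))             ≡⟨ solve 4 (λ u a b c → u :+ a :+ b :+ c := u :+ b :+ (c :+ a)) refl (U i) (P (suc i)) (m * mid) (P (suc (suc K ℕ.+ d))) ⟩
    U i + m * mid + (P (suc (suc K ℕ.+ d)) + P (suc i))           ≡⟨ cong (λ k → U i + m * mid + (P (suc k) + P (suc i))) (sym (ℕP.+-suc K d)) ⟩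
    U i + m * mid + (P (suc K ℕ.+ suc d) + P (suc i))             ≡⟨ cong (_+_ (U i + m * mid)) (P-mirror (suc d) (suc i) (cong suc i+d≡)) ⟩
    U i + m * mid + (mid + mid)                                   ≡⟨ solve 3 (λ u m x → u :+ m :* x :+ (x :+ x) := u :+ (con (fromℕ 2) :+ m) :* x) refl (U i) m mid ⟩
    U i + (fromℕ 2 + m) * mid                                     ≡⟨ cong (λ z → U i + z * mid) (fromℕ-+ 2 (suc (d ℕ.+ d))) ⟨
    U i + fromℕ (3 ℕ.+ (d ℕ.+ d)) * mid                           ∎
    where
    open ≡-Reasoning
    m = fromℕ (suc (d ℕ.+ d))
    i+d≡K : suc i ℕ.+ d ≡ K
    i+d≡K = trans (sym (ℕP.+-suc i d)) i+d≡

  U-tail : ∀ f → U (last ℕ.+ f) ≡ fromℕ last * mid + fromℕ f * (mid + mid) + prefix fromℕ f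
  U-tail zero = begin
    U (last ℕ.+ 0)                                 ≡⟨ cong U (ℕP.+-identityʳ last) ⟩
    U last                                         ≡⟨ U-mirror K 0 refl ⟩
    0ℚ + fromℕ last * mid                          ≡⟨ solve 2 (λ l m → con 0ℚ :+ l :* m := l :* m :+ con 0ℚ :* (m :+ m) :+ con 0ℚ) refl (fromℕ last) mid ⟩
    fromℕ last * mid + 0ℚ * (mid + mid) + 0ℚ       ∎
    where open ≡-Reasoning
  U-tail (suc f) = begin
    U (last ℕ.+ suc f)                                                            ≡⟨ cong U (ℕP.+-suc last f) ⟩
    U (last ℕ.+ f) + P (suc last ℕ.+ f)                                           ≡⟨ cong₂ _+_ (U-tail f) (P-tail f) ⟩
    fromℕ last * mid + fromℕ f * (mid + mid) + prefix fromℕ f + (mid + mid + fromℕ f)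
      ≡⟨ solve 4 (λ l f m t → l :* m :+ f :* (m :+ m) :+ t :+ (m :+ m :+ f) := l :* m :+ (con 1ℚ :+ f) :* (m :+ m) :+ (t :+ f)) refl (fromℕ last) (fromℕ f) mid (prefix fromℕ f) ⟩
    fromℕ last * mid + (1ℚ + fromℕ f) * (mid + mid) + (prefix fromℕ f + fromℕ f)  ≡⟨ cong (λ z → fromℕ last * mid + z * (mid + mid) + (prefix fromℕ f + fromℕ f)) (fromℕ-suc f) ⟨
    fromℕ last * mid + fromℕ (suc f) * (mid + mid) + (prefix fromℕ f + fromℕ f)   ∎
    where open ≡-Reasoning

  0≤P : ∀ k → 0ℚ ≤ P k
  0≤P k = P-mono {0} {k} ℕ.z≤n

  -- The instance and its optimal schedule

  cascade : Instance
  cascade = record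
    { jobs      = n
    -- Batch `i` is released when the optimum has finished jobs 0 to `i - 1`, one of each earlier
    -- batch.
    ; release   = λ j → P (level (toℕ j))
    ; size      = λ j → p (toℕ j)
    ; release≥0 = λ j → 0≤P (level (toℕ j))
    ; size>0    = λ j → 0<p (toℕ j)
    }

  opt : Schedule cascade
  opt = sequential cascade p 0<p (λ _ → refl) (λ j → P-mono (level≤k (toℕ j)))

  opt-isOptimal : IsOptimal opt
  opt-isOptimal = nested-optimal opt (λ j → level (toℕ j)) K (λ j → level≤K (toℕ j))
    v (0≤v 0) v-mono (λ j → v*s (level (toℕ j)))
    P 0≤P (λ i j i≤ℓ → P-mono i≤ℓ) consecutive
    where
    consecutive : ∀ i (j : Fin n) → i ℕ.≤ level (toℕ j) →
      P (suc (toℕ j)) ≤ P i + ∑ {n} (λ k → 𝟙 (i ℕP.≤? level (toℕ k)) * p (toℕ k) * 𝟙 (toℕ k ℕP.≤? toℕ j))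
    consecutive i j i≤ℓ = begin
      P (suc m)
        ≡⟨ prefix-as-∑ {n} p (suc m) (FinP.toℕ<n j) ⟩
      ∑ {n} (λ k → 𝟙 (toℕ k ℕP.<? suc m) * p (toℕ k))
        ≤⟨ ∑-mono {n} (λ k → cover (toℕ k)) ⟩
      ∑ {n} (λ k → 𝟙 (toℕ k ℕP.<? i) * p (toℕ k) + 𝟙 (i ℕP.≤? level (toℕ k)) * p (toℕ k) * 𝟙 (toℕ k ℕP.≤? m))
        ≡⟨ ∑-distrib-+ {n} (λ k → 𝟙 (toℕ k ℕP.<? i) * p (toℕ k)) (λ k → 𝟙 (i ℕP.≤? level (toℕ k)) * p (toℕ k) * 𝟙 (toℕ k ℕP.≤? m)) ⟩
      ∑ {n} (λ k → 𝟙 (toℕ k ℕP.<? i) * p (toℕ k)) + ∑ {n} (λ k → 𝟙 (i ℕP.≤? level (toℕ k)) * p (toℕ k) * 𝟙 (toℕ k ℕP.≤? m))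
        ≡⟨ cong (_+ ∑ {n} (λ k → 𝟙 (i ℕP.≤? level (toℕ k)) * p (toℕ k) * 𝟙 (toℕ k ℕP.≤? m))) (prefix-as-∑ {n} p i i≤n) ⟨
      P i + ∑ {n} (λ k → 𝟙 (i ℕP.≤? level (toℕ k)) * p (toℕ k) * 𝟙 (toℕ k ℕP.≤? m)) ∎
      where
      open ≤-Reasoning
      m = toℕ j
      i≤m : i ℕ.≤ m
      i≤m = ℕP.≤-trans i≤ℓ (level≤k m)
      i≤n : i ℕ.≤ n
      i≤n = ℕP.≤-trans i≤m (ℕP.<⇒≤ (FinP.toℕ<n j))

      -- As a minimum of an increasing and a decreasing function, `level` cannot fall below `i`
      -- between the indices `i` and `m`.
      between : ∀ {k} → i ℕ.≤ k → k ℕ.≤ m → i ℕ.≤ level k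
      between {k} i≤k k≤m = ℕP.⊓-glb i≤k (ℕP.≤-trans (ℕP.≤-trans i≤ℓ (ℕP.m⊓n≤n m (last ℕ.∸ m))) (ℕP.∸-monoʳ-≤ last k≤m))

      0≤term : ∀ k → 0ℚ ≤ 𝟙 (i ℕP.≤? level k) * p k * 𝟙 (k ℕP.≤? m)
      0≤term k = 0≤p*q (0≤p*q (0≤𝟙 (i ℕP.≤? level k)) (<⇒≤ (0<p k))) (0≤𝟙 (k ℕP.≤? m))

      cover : ∀ k → 𝟙 (k ℕP.<? suc m) * p k ≤ 𝟙 (k ℕP.<? i) * p k + 𝟙 (i ℕP.≤? level k) * p k * 𝟙 (k ℕP.≤? m)
      cover k with ℕP.<-≤-connex k i | ℕP.≤-<-connex k m
      ... | _ | inj₂ m<k = ≤-trans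
        (≤-reflexive (trans (cong (_* p k) (𝟙-false (k ℕP.<? suc m) (ℕP.≤⇒≯ m<k))) (*-zeroˡ (p k))))
        (0≤p+q (0≤p*q (0≤𝟙 (k ℕP.<? i)) (<⇒≤ (0<p k))) (0≤term k))
      ... | inj₁ k<i | inj₁ k≤m = ≤-by-gap (𝟙 (i ℕP.≤? level k) * p k * 𝟙 (k ℕP.≤? m)) (0≤term k)
        (cong (λ z → z * p k + 𝟙 (i ℕP.≤? level k) * p k * 𝟙 (k ℕP.≤? m))
          (trans (𝟙-true (k ℕP.<? i) k<i) (sym (𝟙-true (k ℕP.<? suc m) (ℕ.s≤s k≤m)))))
      ... | inj₂ i≤k | inj₁ k≤m = ≤-by-gap (𝟙 (k ℕP.<? i) * p k) (0≤p*q (0≤𝟙 (k ℕP.<? i)) (<⇒≤ (0<p k))) (begin-equality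
        x + 𝟙 (i ℕP.≤? level k) * p k * 𝟙 (k ℕP.≤? m)  ≡⟨ cong₂ (λ y z → x + y * p k * z)
          (𝟙-true (i ℕP.≤? level k) (between i≤k k≤m)) (𝟙-true (k ℕP.≤? m) k≤m) ⟩
        x + 1ℚ * p k * 1ℚ                             ≡⟨ solve 2 (λ x y → x :+ con 1ℚ :* y :* con 1ℚ := con 1ℚ :* y :+ x) refl x (p k) ⟩
        1ℚ * p k + x                                  ≡⟨ cong (λ z → z * p k + x) (𝟙-true (k ℕP.<? suc m) (ℕ.s≤s k≤m)) ⟨
        𝟙 (k ℕP.<? suc m) * p k + x                   ∎)
        where x = 𝟙 (k ℕP.<? i) * p k

  -- The Round-Robin schedule of the instance

  end : ℚ
  end = P n

  end≡ : end ≡ mid + mid + fromℕ e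
  end≡ = trans (cong P (ℕP.+-suc last e)) (P-tail e)

  -- When the last batch arrives, the time the optimum still needs equals the work Round-Robin has
  -- left: `s K` for each of the `suc (others K)` jobs.
  end-P-K : end - P K ≡ fromℕ (suc (others K)) * s K
  end-P-K = begin
    end - P K                              ≡⟨ cong (λ z → z - P K) end≡ ⟩
    P K + p K + (P K + p K) + fromℕ e - P K  ≡⟨ cong₂ (λ x z → x + z + (x + z) + fromℕ e - x) (P-ascending K (ℕP.n≤1+n K)) (cong s (level-ascending {K} ℕP.≤-refl)) ⟩
    x + s K + (x + s K) + fromℕ e - x      ≡⟨ cong (λ z → (c K - 1ℚ) * s K - (z - 1ℚ) + s K + ((c K - 1ℚ) * s K - (z - 1ℚ) + s K) + fromℕ e - ((c K - 1ℚ) * s K - (z - 1ℚ))) c₀≡ ⟩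
    (c K - 1ℚ) * s K - (1ℚ + fromℕ e - 1ℚ) + s K + ((c K - 1ℚ) * s K - (1ℚ + fromℕ e - 1ℚ) + s K) + fromℕ e - ((c K - 1ℚ) * s K - (1ℚ + fromℕ e - 1ℚ))
      ≡⟨ solve 3 (λ c s e → (c :- con 1ℚ) :* s :- (con 1ℚ :+ e :- con 1ℚ) :+ s :+ ((c :- con 1ℚ) :* s :- (con 1ℚ :+ e :- con 1ℚ) :+ s) :+ e :- ((c :- con 1ℚ) :* s :- (con 1ℚ :+ e :- con 1ℚ)) := (con 1ℚ :+ c) :* s) refl (c K) (s K) (fromℕ e) ⟩
    (1ℚ + c K) * s K                       ≡⟨ cong (_* s K) (fromℕ-suc (others K)) ⟨
    fromℕ (suc (others K)) * s K           ∎
    where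
    open ≡-Reasoning
    x = (c K - 1ℚ) * s K - (c 0 - 1ℚ)
    c₀≡ : c 0 ≡ 1ℚ + fromℕ e
    c₀≡ = trans (cong fromℕ (ℕP.+-identityʳ ρ)) (fromℕ-suc e)

  -- Release dates of the batches, then the common end. It stays constant beyond `suc K`, which
  -- keeps it monotone on all of ℕ.
  τ : ℕ → ℚ
  τ i = if does (i ℕP.≤? K) then P i else end

  rest : ℕ → ℚ
  rest i = if does (i ℕP.≤? K) then s i else 0ℚ

  τ-early : ∀ {i} → i ℕ.≤ K → τ i ≡ P i
  τ-early {i} i≤K = cong (λ b → if b then P i else end) (dec-true (i ℕP.≤? K) i≤K)

  τ-late : ∀ {i} → K ℕ.< i → τ i ≡ end
  τ-late {i} K<i = cong (λ b → if b then P i else end) (dec-false (i ℕP.≤? K) (ℕP.<⇒≱ K<i))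

  rest-early : ∀ {i} → i ℕ.≤ K → rest i ≡ s i
  rest-early {i} i≤K = cong (λ b → if b then s i else 0ℚ) (dec-true (i ℕP.≤? K) i≤K)

  rest-late : ∀ {i} → K ℕ.< i → rest i ≡ 0ℚ
  rest-late {i} K<i = cong (λ b → if b then s i else 0ℚ) (dec-false (i ℕP.≤? K) (ℕP.<⇒≱ K<i))

  P-K<end : P K < end
  P-K<end = <-by-gap (fromℕ (suc (others K)) * s K) (0<p*q (0<fromℕ (others K)) (0<s K))
    (trans (solve 2 (λ x y → y := x :+ (y :- x)) refl (P K) end) (cong (_+_ (P K)) end-P-K))

  τ-mono : ∀ i → τ i ≤ τ (suc i)
  τ-mono i with ℕP.<-cmp i K
  ... | tri< i<K _ _ = subst₂ _≤_ (sym (τ-early (ℕP.<⇒≤ i<K))) (sym (τ-early i<K)) (P-mono (ℕP.n≤1+n i))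
  ... | tri≈ _ refl _ = subst₂ _≤_ (sym (τ-early {i} ℕP.≤-refl)) (sym (τ-late {suc i} ℕP.≤-refl)) (<⇒≤ P-K<end)
  ... | tri> _ _ K<i = ≤-reflexive (trans (τ-late K<i) (sym (τ-late (ℕP.m<n⇒m<1+n K<i))))

  arrivals : ℕ → Subset n
  arrivals = arrived cascade (λ j → level (toℕ j))

  -- Exactly the indices strictly between i and last ∸ i have a larger level.
  ∣arrivals∣ : ∀ i → i ℕ.≤ K → ∣ arrivals i ∣ ≡ suc (others i)
  ∣arrivals∣ i i≤K = fromℕ-injective (begin
    fromℕ ∣ arrivals i ∣                             ≡⟨ ∑-𝟙-count {n} (λ j → level (toℕ j) ℕP.≤? i) ⟨
    ∑ {n} (λ j → 𝟙 (level (toℕ j) ℕP.≤? i))          ≡⟨ ∑≡prefix n χ ⟩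
    prefix χ n                                       ≡⟨ cong (prefix χ) n≡ ⟩
    prefix χ (suc i ℕ.+ (h ℕ.+ h) ℕ.+ (i ℕ.+ ρ))     ≡⟨ prefix-const χ (suc i ℕ.+ (h ℕ.+ h)) (i ℕ.+ ρ) 1ℚ (λ d _ → 𝟙-true (level _ ℕP.≤? i) (third d)) ⟩
    prefix χ (suc i ℕ.+ (h ℕ.+ h)) + fromℕ (i ℕ.+ ρ) * 1ℚ
      ≡⟨ cong (_+ fromℕ (i ℕ.+ ρ) * 1ℚ) (prefix-const χ (suc i) (h ℕ.+ h) 0ℚ (λ d d<2h → 𝟙-false (level _ ℕP.≤? i) (ℕP.<⇒≱ (second d d<2h)))) ⟩
    prefix χ (suc i) + fromℕ (h ℕ.+ h) * 0ℚ + fromℕ (i ℕ.+ ρ) * 1ℚ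
      ≡⟨ cong (λ z → z + fromℕ (h ℕ.+ h) * 0ℚ + fromℕ (i ℕ.+ ρ) * 1ℚ)
           (prefix-const χ 0 (suc i) 1ℚ (λ d d≤i → 𝟙-true (level d ℕP.≤? i) (ℕP.≤-trans (level≤k d) (ℕP.≤-pred d≤i)))) ⟩
    0ℚ + fromℕ (suc i) * 1ℚ + fromℕ (h ℕ.+ h) * 0ℚ + fromℕ (i ℕ.+ ρ) * 1ℚ
      ≡⟨ solve 3 (λ x y z → con 0ℚ :+ x :* con 1ℚ :+ y :* con 0ℚ :+ z :* con 1ℚ := x :+ z) refl (fromℕ (suc i)) (fromℕ (h ℕ.+ h)) (fromℕ (i ℕ.+ ρ)) ⟩
    fromℕ (suc i) + fromℕ (i ℕ.+ ρ)                  ≡⟨ fromℕ-+ (suc i) (i ℕ.+ ρ) ⟨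
    fromℕ (suc i ℕ.+ (i ℕ.+ ρ))                      ≡⟨ cong fromℕ (solveℕ 2 (λ i r → conℕ 1 :+ℕ i :+ℕ (i :+ℕ r) :=ℕ conℕ 1 :+ℕ (r :+ℕ (i :+ℕ i))) refl i ρ) ⟩
    fromℕ (suc (others i))                           ∎)
    where
    open ≡-Reasoning
    χ : ℕ → ℚ
    χ k = 𝟙 (level k ℕP.≤? i)
    h = K ℕ.∸ i
    last≡ : last ≡ suc i ℕ.+ (h ℕ.+ h) ℕ.+ i
    last≡ = trans (cong (λ k → suc (k ℕ.+ k)) (sym (ℕP.m+[n∸m]≡n i≤K)))
      (solveℕ 2 (λ i h → conℕ 1 :+ℕ (i :+ℕ h :+ℕ (i :+ℕ h)) :=ℕ conℕ 1 :+ℕ i :+ℕ (h :+ℕ h) :+ℕ i) refl i h)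
    n≡ : n ≡ suc i ℕ.+ (h ℕ.+ h) ℕ.+ (i ℕ.+ ρ)
    n≡ = trans (cong (ℕ._+ ρ) last≡) (ℕP.+-assoc (suc i ℕ.+ (h ℕ.+ h)) i ρ)
    third : ∀ d → level (suc i ℕ.+ (h ℕ.+ h) ℕ.+ d) ℕ.≤ i
    third d = level≤ (suc i ℕ.+ (h ℕ.+ h) ℕ.+ d) (subst (ℕ._≤ suc i ℕ.+ (h ℕ.+ h) ℕ.+ d ℕ.+ i) (sym last≡)
      (ℕP.+-monoˡ-≤ i (ℕP.m≤m+n (suc i ℕ.+ (h ℕ.+ h)) d)))
    second : ∀ d → d ℕ.< h ℕ.+ h → suc i ℕ.≤ level (suc i ℕ.+ d)
    second d d<2h = ≤level (ℕP.m≤m+n (suc i) d) (subst (suc i ℕ.+ (suc i ℕ.+ d) ℕ.≤_) (sym last≡)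
      (subst (ℕ._≤ suc i ℕ.+ (h ℕ.+ h) ℕ.+ i) (solveℕ 2 (λ i d → conℕ 1 :+ℕ i :+ℕ (conℕ 1 :+ℕ d) :+ℕ i :=ℕ conℕ 1 :+ℕ i :+ℕ (conℕ 1 :+ℕ i :+ℕ d)) refl i d)
        (ℕP.+-monoˡ-≤ i (ℕP.+-monoʳ-≤ (suc i) d<2h))))

  -- Before the last batch an interval has length `s i`, and `s-drop` is the loss of one share. The
  -- final interval is long enough for every job to receive all of `s K`.
  rest-step′ : ∀ i → i ℕ.≤ K → rest i ≡ rest (suc i) + reciprocal (suc (others i)) * (τ (suc i) - τ i)
  rest-step′ i i≤K with ℕP.m≤n⇒m<n∨m≡n i≤K
  ... | inj₁ i<K = begin
    rest i                              ≡⟨ rest-early i≤K ⟩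
    s i                                 ≡⟨ s-drop i ⟩
    s (suc i) + q * s i                 ≡⟨ cong₂ (λ x y → x + q * y) (sym (rest-early i<K)) s≡gap ⟩
    rest (suc i) + q * (τ (suc i) - τ i) ∎
    where
    open ≡-Reasoning
    q = reciprocal (suc (others i))
    s≡gap : s i ≡ τ (suc i) - τ i
    s≡gap = begin
      s i                ≡⟨ cong s (level-ascending i≤K) ⟨
      p i                ≡⟨ solve 2 (λ x y → y := x :+ y :- x) refl (P i) (p i) ⟩
      P (suc i) - P i    ≡⟨ cong₂ _-_ (sym (τ-early i<K)) (sym (τ-early i≤K)) ⟩
      τ (suc i) - τ i    ∎
  ... | inj₂ refl = begin
    rest K                              ≡⟨ rest-early {K} ℕP.≤-refl ⟩
    s K                                 ≡⟨ *-identityˡ (s K) ⟨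
    1ℚ * s K                            ≡⟨ cong (_* s K) (fromℕ*reciprocal (others K)) ⟨
    N * q * s K                         ≡⟨ solve 3 (λ n q s → n :* q :* s := con 0ℚ :+ q :* (n :* s)) refl N q (s K) ⟩
    0ℚ + q * (N * s K)                  ≡⟨ cong₂ (λ x y → x + q * y) (sym (rest-late {suc K} ℕP.≤-refl)) (sym end-P-K) ⟩
    rest (suc K) + q * (end - P K)      ≡⟨ cong₂ (λ x y → rest (suc K) + q * (x - y)) (sym (τ-late {suc K} ℕP.≤-refl)) (sym (τ-early {K} ℕP.≤-refl)) ⟩
    rest (suc K) + q * (τ (suc K) - τ K) ∎
    where
    open ≡-Reasoning
    N = fromℕ (suc (others K))
    q = reciprocal (suc (others K))

  rest-step : ∀ i → i ℕ.≤ K → rest i ≡ rest (suc i) + reciprocal ∣ arrivals i ∣ * (τ (suc i) - τ i)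
  rest-step i i≤K = subst (λ k → rest i ≡ rest (suc i) + reciprocal k * (τ (suc i) - τ i)) (sym (∣arrivals∣ i i≤K)) (rest-step′ i i≤K)

  τ-top : τ K < τ (suc K)
  τ-top = subst₂ _<_ (sym (τ-early {K} ℕP.≤-refl)) (sym (τ-late {suc K} ℕP.≤-refl)) P-K<end

  0<share : 0ℚ < reciprocal ∣ arrivals K ∣
  0<share = subst (λ k → 0ℚ < reciprocal k) (sym (∣arrivals∣ K ℕP.≤-refl)) (0<reciprocal (others K))

  rr : Schedule cascade
  rr = roundRobin cascade (λ j → level (toℕ j)) K (λ j → level≤K (toℕ j))
    τ refl τ-mono τ-top (λ j → sym (τ-early (level≤K (toℕ j))))
    rest (rest-late {suc K} ℕP.≤-refl) rest-step (λ j → sym (rest-early (level≤K (toℕ j)))) 0<share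

  rr-isRoundRobin : IsRoundRobin rr
  rr-isRoundRobin = roundRobin-isRoundRobin cascade (λ j → level (toℕ j)) K (λ j → level≤K (toℕ j))
    τ refl τ-mono τ-top (λ j → sym (τ-early (level≤K (toℕ j))))
    rest (rest-late {suc K} ℕP.≤-refl) rest-step (λ j → sym (rest-early (level≤K (toℕ j)))) 0<share

  -- Objective values in terms of the turning point

  opt-total : Schedule.totalCompletionTime opt ≡ fromℕ last * mid + fromℕ ρ * (mid + mid) + prefix fromℕ ρ
  opt-total = trans (∑≡prefix n (λ k → P (suc k))) (U-tail ρ)

  rr-total : Schedule.totalCompletionTime rr ≡ fromℕ n * (mid + mid + fromℕ e)
  rr-total = trans (∑-const n (τ (suc K))) (cong (_*_ (fromℕ n)) (trans (τ-late {suc K} ℕP.≤-refl) end≡))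

  -- Makes both objective values affine in `s K`.
  mid≡ : mid ≡ c K * s K - fromℕ e
  mid≡ = begin
    P K + p K                              ≡⟨ cong₂ _+_ (P-ascending K (ℕP.n≤1+n K)) (cong s (level-ascending {K} ℕP.≤-refl)) ⟩
    (c K - 1ℚ) * s K - (c 0 - 1ℚ) + s K    ≡⟨ cong (λ z → (c K - 1ℚ) * s K - (z - 1ℚ) + s K) (trans (cong fromℕ (ℕP.+-identityʳ ρ)) (fromℕ-suc e)) ⟩
    (c K - 1ℚ) * s K - (1ℚ + fromℕ e - 1ℚ) + s K
      ≡⟨ solve 3 (λ c s e → (c :- con 1ℚ) :* s :- (con 1ℚ :+ e :- con 1ℚ) :+ s := c :* s :- e) refl (c K) (s K) (fromℕ e) ⟩
    c K * s K - fromℕ e                    ∎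
    where open ≡-Reasoning

-- The ratio at concrete parameters

ratio-≥ : ∀ {I} (RR OPT : Schedule I) → IsRoundRobin RR → IsOptimal OPT → let open Schedule in
  0ℚ < totalCompletionTime OPT → ∀ a → a * totalCompletionTime OPT ≤ totalCompletionTime RR →
  ∃[ q ] IsRoundRobinRatio q × a ≤ q
ratio-≥ {I} RR OPT isRR isOPT 0<OPT a a*OPT≤RR =
  q , (I , RR , OPT , isRR , isOPT , 0<OPT , q*OPT≡RR) ,
  *-cancelʳ-≤-pos opt (≤-trans a*OPT≤RR (≤-reflexive (sym q*OPT≡RR)))
  where
  opt = Schedule.totalCompletionTime OPT
  alg = Schedule.totalCompletionTime RR
  instance
    pos-opt : Positive opt
    pos-opt = positive 0<OPT
    nonZero-opt : NonZero opt
    nonZero-opt = pos⇒nonZero opt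
  q = alg * 1/ opt
  q*OPT≡RR : q * opt ≡ alg
  q*OPT≡RR = trans (*-assoc alg (1/ opt) opt) (trans (cong (_*_ alg) (*-inverseˡ opt)) (*-identityʳ alg))

-- With s K = √(c 0 / c K), the ratio is largest for c K / c 0 near 6.9 (and K → ∞);
-- c K / c 0 = 640 / 90 is close to that and makes the root rational.
ratio-large : ∀ K → K ℕ.+ K ≡ 550 → ∃[ q ] IsRoundRobinRatio q × + 21906 / 10000 ≤ q
ratio-large K 2K≡550 = ratio-≥ rr opt rr-isRoundRobin opt-isOptimal 0<total a a*OPT≤RR
  where
  open LowerBoundInstance K 89

  -- The objectives are `641 * (2 * mid + 89)` and `731 * mid + 4005`. Thus Round-Robin minus `a`
  -- times the optimum has slope `- A` in `mid` and value `B` at `mid = 151`; both `A` and `B` are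
  -- positive.
  a A B : ℚ
  a = + 21906 / 10000
  A = a * fromℕ 731 - fromℕ 1282
  B = fromℕ 641 * fromℕ 89 - a * fromℕ 4005 - A * fromℕ 151

  c-K : c K ≡ fromℕ 640
  c-K = cong (λ k → fromℕ (90 ℕ.+ k)) 2K≡550

  s≤3/8 : s K ≤ + 3 / 8
  s≤3/8 = ≮⇒≥ λ 3/8<s → ≤⇒≯ (s²c≤c₀ K) (begin-strict
    c 0                                 ≡⟨⟩
    -- Here `c 0 = 90`, and 90 / 640 = 9 / 64 is the square of 3 / 8.
    (+ 3 / 8) * (+ 3 / 8) * fromℕ 640   <⟨ *-monoˡ-<-pos (fromℕ 640) (begin-strict
      (+ 3 / 8) * (+ 3 / 8)               <⟨ *-monoˡ-<-pos (+ 3 / 8) 3/8<s ⟩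
      s K * (+ 3 / 8)                     <⟨ *-monoʳ-<-pos (s K) {{positive (0<s K)}} 3/8<s ⟩
      s K * s K                           ∎) ⟩
    s K * s K * fromℕ 640               ≡⟨ cong (_*_ (s K * s K)) c-K ⟨
    s K * s K * c K                     ∎)
    where open ≤-Reasoning

  mid≤151 : mid ≤ fromℕ 151
  mid≤151 = begin
    mid                                 ≡⟨ mid≡ ⟩
    c K * s K - fromℕ 89                ≡⟨ cong (λ z → z * s K - fromℕ 89) c-K ⟩
    fromℕ 640 * s K - fromℕ 89          ≤⟨ +-monoˡ-≤ (- fromℕ 89) (*-monoˡ-≤ (0≤fromℕ 640) s≤3/8) ⟩
    fromℕ 640 * (+ 3 / 8) - fromℕ 89    ≡⟨⟩
    fromℕ 151                           ∎
    where open ≤-Reasoning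

  total≡ : Schedule.totalCompletionTime opt ≡ fromℕ 731 * mid + fromℕ 4005
  total≡ = begin
    Schedule.totalCompletionTime opt                      ≡⟨ opt-total ⟩
    -- The constant 4005 is 0 + 1 + ... + 89, that is `prefix fromℕ 90`.
    fromℕ last * mid + fromℕ 90 * (mid + mid) + fromℕ 4005  ≡⟨ cong (λ k → fromℕ (suc k) * mid + fromℕ 90 * (mid + mid) + fromℕ 4005) 2K≡550 ⟩
    fromℕ 551 * mid + fromℕ 90 * (mid + mid) + fromℕ 4005 ≡⟨ solve 1 (λ m → con (fromℕ 551) :* m :+ con (fromℕ 90) :* (m :+ m) :+ con (fromℕ 4005) := con (fromℕ 731) :* m :+ con (fromℕ 4005)) refl mid ⟩
    fromℕ 731 * mid + fromℕ 4005                          ∎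
    where open ≡-Reasoning

  0<total : 0ℚ < Schedule.totalCompletionTime opt
  0<total = subst (0ℚ <_) (sym total≡) (+-mono-≤-< (0≤p*q (0≤fromℕ 731) (0≤P (suc K))) (0<fromℕ 4004))

  a*OPT≤RR : a * Schedule.totalCompletionTime opt ≤ Schedule.totalCompletionTime rr
  -- The difference decreases in `mid`, so the upper bound 151 is the worst case, and there `B` is
  -- left.
  a*OPT≤RR = ≤-by-gap (A * (fromℕ 151 - mid) + B)
    (0≤p+q (0≤p*q (nonNegative⁻¹ A) (p≤q⇒0≤q-p mid≤151)) (nonNegative⁻¹ B))
    (begin
    Schedule.totalCompletionTime rr                       ≡⟨ rr-total ⟩
    fromℕ n * (mid + mid + fromℕ 89)                      ≡⟨ cong (λ k → fromℕ (suc k ℕ.+ 90) * (mid + mid + fromℕ 89)) 2K≡550 ⟩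
    fromℕ 641 * (mid + mid + fromℕ 89)                    ≡⟨ solve 1 (λ m → con (fromℕ 641) :* (m :+ m :+ con (fromℕ 89)) := con a :* (con (fromℕ 731) :* m :+ con (fromℕ 4005)) :+ (con A :* (con (fromℕ 151) :- m) :+ con B)) refl mid ⟩
    a * (fromℕ 731 * mid + fromℕ 4005) + (A * (fromℕ 151 - mid) + B)  ≡⟨ cong (λ z → a * z + (A * (fromℕ 151 - mid) + B)) total≡ ⟨
    a * Schedule.totalCompletionTime opt + (A * (fromℕ 151 - mid) + B) ∎)
    where open ≡-Reasoning

≤-ratio⇒≤sup : ∀ {a P} → ∃[ q ] P q × a ≤ q → a ≤sup P
≤-ratio⇒≤sup (q , Pq , a≤q) b b<a = q , Pq , <-≤-trans b<a a≤q

theorem13 : (+ 21906 / 10000) ≤sup IsRoundRobinRatio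
-- With `K = 275` and `ρ = 90`, `c K = 90 + 550 = 640`.
theorem13 = ≤-ratio⇒≤sup (ratio-large 275 refl)
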